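{- Let $n\in\mathbb{N}$, $n\geq 2$. There is a computable abelian group $(G,+,0)$ and an element $b\in G$, $b\neq 0$, such that, if $c$ is a finite coloring of $G$ (with any finite number of colors) for which the equation $$(x_1-y_1)+\dots+(x_n-y_n)=b$$ has no pairwise monochromatic solutions and there is an integer $m>0$ such that all the elements $kmb$, $k\in\mathbb{Z}$, are colored by $c$ with the same color, then $c$ has PA degree.
   Context: A computable group is a group whose underlying set and group operations are computable. A finite coloring of $G$ is a map $c:G\to k=\{0,\dots,k-1\}$ for some $k\in\mathbb{N}$, $k>1$. A tuple $(x_1,y_1,\dots,x_n,y_n)\in G^{2n}$ is pairwise monochromatic for $c$ if $c(x_i)=c(y_i)$ for all $i=1,\dots,n$; a pairwise monochromatic solution of an equation is a solution that is pairwise monochromatic for $c$. A tree is a set of finite strings closed under initial segments; a binary tree is a tree contained in $2^{<\mathbb{N}}$. A set (or function) $X$ has PA degree if every computable infinite binary tree has an $X$-computable infinite path. -}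

module Defs where

open import Level using (0ℓ)
open import Algebra.Bundles using (AbelianGroup)
open import Algebra.Structures using (IsAbelianGroup)
import Algebra.Definitions.RawMonoid as RawMonoidDefinitions
open import Data.Bool using (Bool; T; if_then_else_)
open import Data.Bool.Properties using (T?)
open import Data.Fin using (Fin; toℕ)
open import Data.Integer using (ℤ; +_; -[1+_])
open import Data.List using (List; []; _∷_; _++_; applyUpTo)
open import Data.List.Membership.Propositional using (_∈_)
open import Data.Nat using (ℕ; zero; suc; _<_; _+_; _*_)
open import Data.Product using (Σ; ∃; _×_; _,_; proj₁)
open import Data.Vec using (Vec; []; _∷_; lookup)
open import Data.Vec.Functional using (Vector)
open import Function using (_∘_)
open import Relation.Binary.PropositionalEquality using (_≡_)
open import Relation.Nullary using (¬_; yes; no)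

-- Kleene's partial recursive functionals with one oracle ℕ → ℕ
data Code : ℕ → Set where
  zeroᶜ  : ∀ {n} → Code n
  sucᶜ   : Code 1
  projᶜ  : ∀ {n} → Fin n → Code n
  oracle : Code 1
  comp   : ∀ {m n} → Code m → Vec (Code n) m → Code n
  prec   : ∀ {n} → Code n → Code (2 + n) → Code (1 + n)
  mu     : ∀ {n} → Code (1 + n) → Code n

-- X ⊢ p [ xs ]⇓ y : the computation of p with oracle X on input xs halts
-- with output y.

infix 4 _⊢_[_]⇓_

data _⊢_[_]⇓_ (X : ℕ → ℕ) : ∀ {n} → Code n → Vec ℕ n → ℕ → Set where
  ⇓-zero   : ∀ {n} {xs : Vec ℕ n} → X ⊢ zeroᶜ [ xs ]⇓ 0
  ⇓-suc    : ∀ {x} → X ⊢ sucᶜ [ x ∷ [] ]⇓ suc x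
  ⇓-proj   : ∀ {n} {xs : Vec ℕ n} (i : Fin n) → X ⊢ projᶜ i [ xs ]⇓ lookup xs i
  ⇓-oracle : ∀ {x} → X ⊢ oracle [ x ∷ [] ]⇓ X x
  ⇓-comp   : ∀ {m n} {p : Code m} {qs : Vec (Code n) m}
               {xs : Vec ℕ n} {ys : Vec ℕ m} {z} →
             (∀ i → X ⊢ lookup qs i [ xs ]⇓ lookup ys i) →
             X ⊢ p [ ys ]⇓ z →
             X ⊢ comp p qs [ xs ]⇓ z
  ⇓-prec₀  : ∀ {n} {p : Code n} {q : Code (2 + n)} {xs y} →
             X ⊢ p [ xs ]⇓ y →
             X ⊢ prec p q [ 0 ∷ xs ]⇓ y
  ⇓-precₛ  : ∀ {n} {p : Code n} {q : Code (2 + n)} {k xs y z} →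
             X ⊢ prec p q [ k ∷ xs ]⇓ y →
             X ⊢ q [ k ∷ y ∷ xs ]⇓ z →
             X ⊢ prec p q [ suc k ∷ xs ]⇓ z
  ⇓-mu     : ∀ {n} {p : Code (1 + n)} {xs y} →
             (∀ {i} → i < y → ∃ λ z → X ⊢ p [ i ∷ xs ]⇓ suc z) →
             X ⊢ p [ y ∷ xs ]⇓ 0 →
             X ⊢ mu p [ xs ]⇓ y

-- Computability without an oracle is computability relative to ∅.

∅ : ℕ → ℕ
∅ _ = 0

_-Computable : (ℕ → ℕ) → (ℕ → ℕ) → Set
(X -Computable) f = ∃ λ (p : Code 1) → ∀ x → X ⊢ p [ x ∷ [] ]⇓ f x

bit : Bool → ℕ
bit b = if b then 1 else 0

-- Bijective base-2 numeration, a computable bijection between 2^{<ℕ} and ℕ.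

⌜_⌝ : List Bool → ℕ
⌜ [] ⌝    = 0
⌜ b ∷ σ ⌝ = 1 + bit b + 2 * ⌜ σ ⌝

-- Sets of strings are given by their characteristic functions; this loses
-- nothing, since only computable sets are considered.

StringSet : Set
StringSet = List Bool → Bool

IsTree : StringSet → Set
IsTree S = ∀ σ τ → T (S (σ ++ τ)) → T (S σ)

IsComputable : StringSet → Set
IsComputable S = ∃ λ (p : Code 1) → ∀ σ → ∅ ⊢ p [ ⌜ σ ⌝ ∷ [] ]⇓ bit (S σ)

IsInfinite : StringSet → Set
IsInfinite S = ¬ (∃ λ (l : List (List Bool)) → ∀ σ → T (S σ) → σ ∈ l)

IsPath : StringSet → (ℕ → Bool) → Set
IsPath S f = ∀ n → T (S (applyUpTo f n))

HasPADegree : (ℕ → ℕ) → Set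
HasPADegree X = ∀ S → IsTree S → IsComputable S → IsInfinite S →
  ∃ λ (f : ℕ → Bool) → (X -Computable) (bit ∘ f) × IsPath S f

record ComputableAbelianGroup : Set where
  infixl 6 _⊕_
  field
    dom            : ℕ → Bool
    dom-computable : (∅ -Computable) (bit ∘ dom)

  -- Since T (dom x) is proof-irrelevant, _≡_ on Carrier is equality of the
  -- underlying numbers.
  Carrier : Set
  Carrier = Σ ℕ (T ∘ dom)

  field
    _⊕_            : Carrier → Carrier → Carrier
    0#             : Carrier
    ⊖_             : Carrier → Carrier
    isAbelianGroup : IsAbelianGroup _≡_ _⊕_ 0# ⊖_
    ⊕-computable   : ∃ λ (p : Code 2) → ∀ x y →
                     ∅ ⊢ p [ proj₁ x ∷ proj₁ y ∷ [] ]⇓ proj₁ (x ⊕ y)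
    ⊖-computable   : ∃ λ (p : Code 1) → ∀ x →
                     ∅ ⊢ p [ proj₁ x ∷ [] ]⇓ proj₁ (⊖ x)

  abelianGroup : AbelianGroup 0ℓ 0ℓ
  abelianGroup = record { isAbelianGroup = isAbelianGroup }

  open AbelianGroup abelianGroup public using (rawMonoid; _-_)
  open RawMonoidDefinitions rawMonoid public using (sum) renaming (_×_ to _·ℕ_)

  infixr 8 _·_
  _·_ : ℤ → Carrier → Carrier
  (+ k)    · x = k ·ℕ x
  -[1+ k ] · x = ⊖ (suc k ·ℕ x)

module _ (G : ComputableAbelianGroup) where
  open ComputableAbelianGroup G

  Coloring : ℕ → Set
  Coloring k = Carrier → Fin k

  PairwiseMonochromatic : ∀ {k n} → Coloring k →
                          Vector Carrier n → Vector Carrier n → Set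
  PairwiseMonochromatic c x y = ∀ i → c (x i) ≡ c (y i)

  IsSolution : ∀ {n} → Carrier → Vector Carrier n → Vector Carrier n → Set
  IsSolution b x y = sum (λ i → x i - y i) ≡ b

  NoPairwiseMonochromaticSolution : ∀ {k} → ℕ → Carrier → Coloring k → Set
  NoPairwiseMonochromaticSolution n b c =
    ¬ (∃ λ (x : Vector Carrier n) → ∃ λ (y : Vector Carrier n) →
         IsSolution b x y × PairwiseMonochromatic c x y)

  -- The coloring as an oracle.  Outside the domain of G the value is the
  -- constant 0, so that the oracle carries no information beyond c; as the
  -- domain is computable, it is Turing equivalent to the graph of c.
  toOracle : ∀ {k} → Coloring k → ℕ → ℕ
  toOracle c x with T? (dom x)
  ... | yes x∈G = toℕ (c (x , x∈G))
  ... | no  _   = 0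

{-# OPTIONS --safe #-}

-- G is generated by b and elements g i, one for each pair i of a program and an input (and a bound on m).
-- If i is seen to halt at stage s with output 0 or 1, then g i is made equal to (2 + s)! b or ((2 + s)! + 1) b.
-- These coefficients grow so fast that whether a given combination of generators vanishes is settled at a stage
-- bounded by its size, so that G is computable.  For n ≥ 2 a colouring without pairwise monochromatic solutions
-- that is constant on the multiples of m b distinguishes the elements of b + ℤ m b from 0, but not those of ℤ m b.
-- Comparing the colours of g i and 0 thus extends every {0,1}-valued partial recursive function to a total one,
-- and such an extension tells which child to choose in order to stay in the infinite part of a computable tree.

module Submission where

open import Defs
open import Algebra.Bundles using (AbelianGroup)
import Algebra.Properties.Group as GroupProperties
open import Algebra.Structures using (IsAbelianGroup)
open import Data.Bool using (Bool; true; false; T)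
open import Data.Bool.Properties using (T-irrelevant; T?)
open import Data.Empty using (⊥)
open import Data.Fin using (Fin; zero; suc; toℕ)
open import Data.Fin.Patterns using (0F; 1F; 2F; 3F; 4F)
open import Data.Fin.Properties using (toℕ-injective)
import Data.Integer as ℤ
open import Data.Integer using (ℤ; 0ℤ; _⊖_) renaming (_<_ to _<ᶻ_; _*_ to _*ᶻ_)
import Data.Integer.Properties as ℤ
open import Data.Integer.Tactic.RingSolver using () renaming (solve-∀ to solve-∀ℤ)
import Data.List as List
open import Data.List using (List; []; _∷_; _++_; [_]; length; applyUpTo; take; drop; upTo)
open import Data.List.Membership.Propositional using (_∈_)
open import Data.List.Membership.Propositional.Properties using (∈-map⁺; ∈-upTo⁺)
open import Data.List.Properties
  using (length-++; length-take; take++drop≡id; ++-assoc; applyUpTo-∷ʳ)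
open import Data.Nat
open import Data.Nat.Divisibility using (divides; ∣-trans; m∣m*n; m≤n⇒m!∣n!)
open import Data.Nat.Properties
open import Data.Nat.Tactic.RingSolver using (solve-∀)
open import Data.Product using (∃; _×_; _,_; proj₁; proj₂)
open import Data.Sum using (_⊎_; inj₁; inj₂; map₁)
open import Data.Vec using (Vec; []; _∷_; lookup; tabulate)
open import Data.Vec.Properties using (lookup∘tabulate)
open import Function using (_∘_)
open import Level using (0ℓ)
import Relation.Binary.PropositionalEquality as Eq
open import Relation.Binary.PropositionalEquality hiding (isEquivalence; [_])
open import Relation.Nullary using (¬_; yes; no; contradiction)
open import Relation.Nullary.Decidable using (decidable-stable)

-- Total programs

-- The bound on m is there for divisibility. As m is unknown while G is built, every program is
-- paired with every candidate `M`. The resulting index is at least `M`, and the stage that ties the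
-- generator `i` to b is at least `i`. Hence `M` divides the factorial used there, and the weight is
-- congruent to the output modulo `M`. The obstacle is that no algorithm tells which generators stay
-- free, so G cannot be written down as the free group on b and those. A combination is instead
-- represented by its coordinates at all stages, and two combinations are equal if their coordinates
-- eventually coincide. Comparing sizes replaces "eventually" by one explicit stage, which makes
-- equality decidable. G and b do not depend on n.

primrec : ℕ → (ℕ → ℕ → ℕ) → ℕ → ℕ
primrec z s zero    = z
primrec z s (suc k) = s k (primrec z s k)

record Fun (X : ℕ → ℕ) (n : ℕ) : Set where
  field
    fn      : Vec ℕ n → ℕ
    code    : Code n
    correct : ∀ xs → X ⊢ code [ xs ]⇓ fn xs

open Fun

-- In rec t z s, the recursion on t, the step s sees the predecessor as var 0 and the previous value as var 1.
data Tm (X : ℕ → ℕ) (n : ℕ) : Set where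
  var  : Fin n → Tm X n
  lit  : ℕ → Tm X n
  succ : Tm X n → Tm X n
  rec  : Tm X n → Tm X n → Tm X (2 + n) → Tm X n
  call : ∀ {m} → Fun X m → Vec (Tm X n) m → Tm X n

uncurry₁ : (ℕ → ℕ) → Vec ℕ 1 → ℕ
uncurry₁ f (a ∷ []) = f a

uncurry₂ : (ℕ → ℕ → ℕ) → Vec ℕ 2 → ℕ
uncurry₂ f (a ∷ b ∷ []) = f a b

uncurry₃ : (ℕ → ℕ → ℕ → ℕ) → Vec ℕ 3 → ℕ
uncurry₃ f (a ∷ b ∷ c ∷ []) = f a b c

module _ {X : ℕ → ℕ} where

  mutual
    ⟦_⟧ : ∀ {n} → Tm X n → Vec ℕ n → ℕ
    ⟦ var i ⟧     ρ = lookup ρ i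
    ⟦ lit k ⟧     ρ = k
    ⟦ succ t ⟧    ρ = suc (⟦ t ⟧ ρ)
    ⟦ rec t z s ⟧ ρ = primrec (⟦ z ⟧ ρ) (λ k r → ⟦ s ⟧ (k ∷ r ∷ ρ)) (⟦ t ⟧ ρ)
    ⟦ call F ts ⟧ ρ = fn F (⟦ ts ⟧* ρ)

    ⟦_⟧* : ∀ {n m} → Vec (Tm X n) m → Vec ℕ n → Vec ℕ m
    ⟦ [] ⟧*     ρ = []
    ⟦ t ∷ ts ⟧* ρ = ⟦ t ⟧ ρ ∷ ⟦ ts ⟧* ρ

  numeral : ∀ {n} → ℕ → Code n
  numeral zero    = zeroᶜ
  numeral (suc k) = comp sucᶜ (numeral k ∷ [])

  mutual
    compile : ∀ {n} → Tm X n → Code n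
    compile (var i)     = projᶜ i
    compile (lit k)     = numeral k
    compile (succ t)    = comp sucᶜ (compile t ∷ [])
    compile (rec t z s) = comp (prec (compile z) (compile s)) (compile t ∷ tabulate projᶜ)
    compile (call F ts) = comp (code F) (compile* ts)

    compile* : ∀ {n m} → Vec (Tm X n) m → Vec (Code n) m
    compile* []       = []
    compile* (t ∷ ts) = compile t ∷ compile* ts

  numeral-correct : ∀ {n} k (ρ : Vec ℕ n) → X ⊢ numeral k [ ρ ]⇓ k
  numeral-correct zero    ρ = ⇓-zero
  numeral-correct (suc k) ρ = ⇓-comp {ys = k ∷ []} (λ { 0F → numeral-correct k ρ }) ⇓-suc

  proj-correct : ∀ {n} (ρ : Vec ℕ n) i → X ⊢ lookup (tabulate projᶜ) i [ ρ ]⇓ lookup ρ i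
  proj-correct ρ i = subst (λ p → X ⊢ p [ ρ ]⇓ lookup ρ i) (sym (lookup∘tabulate projᶜ i)) (⇓-proj i)

  prec-correct : ∀ {n} {p : Code n} {q : Code (2 + n)} (ρ : Vec ℕ n) {z s} →
                 X ⊢ p [ ρ ]⇓ z → (∀ k r → X ⊢ q [ k ∷ r ∷ ρ ]⇓ s k r) →
                 ∀ k → X ⊢ prec p q [ k ∷ ρ ]⇓ primrec z s k
  prec-correct ρ hz hs zero    = ⇓-prec₀ hz
  prec-correct ρ hz hs (suc k) = ⇓-precₛ (prec-correct ρ hz hs k) (hs _ _)

  mutual
    compile-correct : ∀ {n} (t : Tm X n) ρ → X ⊢ compile t [ ρ ]⇓ ⟦ t ⟧ ρ
    compile-correct (var i)     ρ = ⇓-proj i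
    compile-correct (lit k)     ρ = numeral-correct k ρ
    compile-correct (succ t)    ρ =
      ⇓-comp {ys = ⟦ t ⟧ ρ ∷ []} (λ { 0F → compile-correct t ρ }) ⇓-suc
    compile-correct (rec t z s) ρ =
      ⇓-comp {ys = ⟦ t ⟧ ρ ∷ ρ} (λ { zero → compile-correct t ρ ; (suc i) → proj-correct ρ i })
        (prec-correct ρ (compile-correct z ρ) (λ k r → compile-correct s (k ∷ r ∷ ρ)) (⟦ t ⟧ ρ))
    compile-correct (call F ts) ρ = ⇓-comp (compile*-correct ts ρ) (correct F (⟦ ts ⟧* ρ))

    compile*-correct : ∀ {n m} (ts : Vec (Tm X n) m) ρ i →
                       X ⊢ lookup (compile* ts) i [ ρ ]⇓ lookup (⟦ ts ⟧* ρ) i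
    compile*-correct (t ∷ ts) ρ zero    = compile-correct t ρ
    compile*-correct (t ∷ ts) ρ (suc i) = compile*-correct ts ρ i

  -- Only pointwise equality with the meaning of `t` is required, so that `fn` is the intended
  -- function and not a nest of `primrec`s.
  define : ∀ {n} (f : Vec ℕ n → ℕ) (t : Tm X n) → (∀ ρ → ⟦ t ⟧ ρ ≡ f ρ) → Fun X n
  define f t eq = record
    { fn      = f
    ; code    = compile t
    ; correct = λ xs → subst (X ⊢ compile t [ xs ]⇓_) (eq xs) (compile-correct t xs)
    }

  mu-correct : ∀ {n} (F : Fun X (suc n)) (ρ : Vec ℕ n) {y} →
               fn F (y ∷ ρ) ≡ 0 → (∀ {i} → i < y → fn F (i ∷ ρ) ≢ 0) → X ⊢ mu (code F) [ ρ ]⇓ y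
  mu-correct F ρ {y} zero-at nonzero-below = ⇓-mu
    (λ {i} i<y → positive (fn F (i ∷ ρ)) (nonzero-below i<y) (correct F (i ∷ ρ)))
    (subst (X ⊢ code F [ y ∷ ρ ]⇓_) zero-at (correct F (y ∷ ρ)))
    where
    positive : ∀ {p : Code _} {ρ} v → v ≢ 0 → X ⊢ p [ ρ ]⇓ v → ∃ λ z → X ⊢ p [ ρ ]⇓ suc z
    positive zero    v≢0 _ = contradiction refl v≢0
    positive (suc z) _   d = z , d

  minimise : ∀ {n} (F : Fun X (suc n)) (f : Vec ℕ n → ℕ) →
             (∀ ρ → fn F (f ρ ∷ ρ) ≡ 0) → (∀ ρ {i} → i < f ρ → fn F (i ∷ ρ) ≢ 0) → Fun X n
  minimise F f zero-at nonzero-below = record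
    { fn      = f
    ; code    = mu (code F)
    ; correct = λ ρ → mu-correct F ρ (zero-at ρ) (nonzero-below ρ)
    }

  define₁ : (f : ℕ → ℕ) (t : Tm X 1) → (∀ a → ⟦ t ⟧ (a ∷ []) ≡ f a) → Fun X 1
  define₁ f t eq = define (uncurry₁ f) t λ { (a ∷ []) → eq a }

  define₂ : (f : ℕ → ℕ → ℕ) (t : Tm X 2) → (∀ a b → ⟦ t ⟧ (a ∷ b ∷ []) ≡ f a b) → Fun X 2
  define₂ f t eq = define (uncurry₂ f) t λ { (a ∷ b ∷ []) → eq a b }

  define₃ : (f : ℕ → ℕ → ℕ → ℕ) (t : Tm X 3) →
            (∀ a b c → ⟦ t ⟧ (a ∷ b ∷ c ∷ []) ≡ f a b c) → Fun X 3
  define₃ f t eq = define (uncurry₃ f) t λ { (a ∷ b ∷ c ∷ []) → eq a b c }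

  call₁ : ∀ {n} → Fun X 1 → Tm X n → Tm X n
  call₁ F s = call F (s ∷ [])

  call₂ : ∀ {n} → Fun X 2 → Tm X n → Tm X n → Tm X n
  call₂ F s t = call F (s ∷ t ∷ [])

  call₃ : ∀ {n} → Fun X 3 → Tm X n → Tm X n → Tm X n → Tm X n
  call₃ F s t u = call F (s ∷ t ∷ u ∷ [])

  addF : Fun X 2
  addF = define₂ _+_ (rec (var 0F) (var 1F) (succ (var 1F))) eq
    where
    eq : ∀ a b → primrec b (λ _ r → suc r) a ≡ a + b
    eq zero    b = refl
    eq (suc a) b = cong suc (eq a b)

  infixl 6 _⊞_ _⊟_
  infixl 7 _⊠_

  _⊞_ : ∀ {n} → Tm X n → Tm X n → Tm X n
  _⊞_ = call₂ addF

  mulF : Fun X 2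
  mulF = define₂ _*_ (rec (var 0F) (lit 0) (var 3F ⊞ var 1F)) eq
    where
    eq : ∀ a b → primrec 0 (λ _ r → b + r) a ≡ a * b
    eq zero    b = refl
    eq (suc a) b = cong (b +_) (eq a b)

  _⊠_ : ∀ {n} → Tm X n → Tm X n → Tm X n
  _⊠_ = call₂ mulF

  monusF : Fun X 2
  -- The inner `rec`, whose step returns its index, is the predecessor.
  monusF = define₂ _∸_ (rec (var 1F) (var 0F) (rec (var 1F) (lit 0) (var 0F))) eq
    where
    pred-rec : ∀ r → primrec 0 (λ k _ → k) r ≡ pred r
    pred-rec zero    = refl
    pred-rec (suc r) = refl
    eq : ∀ a b → primrec a (λ _ r → primrec 0 (λ k _ → k) r) b ≡ a ∸ b
    eq a zero    = refl
    eq a (suc b) = trans (pred-rec (primrec a _ b)) (trans (cong pred (eq a b)) (pred[m∸n]≡m∸[1+n] a b))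

  _⊟_ : ∀ {n} → Tm X n → Tm X n → Tm X n
  _⊟_ = call₂ monusF

  -- The branch for a successor has the predecessor as var 0; its var 1 is of no use.
  ifz : ∀ {n} → Tm X n → Tm X n → Tm X (2 + n) → Tm X n
  ifz = rec

  -- In the summand, var 0 is the index and var 1 the partial sum.
  sumTo : ∀ {n} → Tm X n → Tm X (2 + n) → Tm X n
  sumTo b t = rec b (lit 0) (var 1F ⊞ t)

-- Sums and distances as zero tests

∑< : ℕ → (ℕ → ℕ) → ℕ
∑< n f = primrec 0 (λ k r → r + f k) n

dist : ℕ → ℕ → ℕ
dist a b = (a ∸ b) + (b ∸ a)

distF : ∀ {X} → Fun X 2
distF = define₂ dist ((var 0F ⊟ var 1F) ⊞ (var 1F ⊟ var 0F)) (λ _ _ → refl)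

dist-self : ∀ a → dist a a ≡ 0
dist-self a rewrite n∸n≡0 a = refl

dist≡0⇒≡ : ∀ a b → dist a b ≡ 0 → a ≡ b
dist≡0⇒≡ a b p = ≤-antisym (m∸n≡0⇒m≤n (m+n≡0⇒m≡0 (a ∸ b) p)) (m∸n≡0⇒m≤n (m+n≡0⇒n≡0 (a ∸ b) p))

∑<-cong : ∀ n {f g : ℕ → ℕ} → (∀ i → i < n → f i ≡ g i) → ∑< n f ≡ ∑< n g
∑<-cong zero    h = refl
∑<-cong (suc n) h = cong₂ _+_ (∑<-cong n (λ i i<n → h i (m<n⇒m<1+n i<n))) (h n (n<1+n n))

∑<-0 : ∀ n {f : ℕ → ℕ} → (∀ i → i < n → f i ≡ 0) → ∑< n f ≡ 0
∑<-0 zero    h = refl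
∑<-0 (suc n) h = cong₂ _+_ (∑<-0 n λ i i<n → h i (m<n⇒m<1+n i<n)) (h n (n<1+n n))

-- Terms cannot cancel in ℕ; bounded universal quantifiers thus become primitive recursive zero
-- tests.
∑<-≡0 : ∀ n {f : ℕ → ℕ} → ∑< n f ≡ 0 → ∀ i → i < n → f i ≡ 0
∑<-≡0 (suc n) p i i<1+n with m≤n⇒m<n∨m≡n (≤-pred i<1+n)
... | inj₁ i<n  = ∑<-≡0 n (m+n≡0⇒m≡0 _ p) i i<n
... | inj₂ refl = m+n≡0⇒n≡0 (∑< n _) p

-- Pairing

opaque
  -- The root grows by one at `suc k` exactly when `suc r * suc r ≤ suc k`, that is, when the
  -- truncated difference vanishes.
  isqrt : ℕ → ℕ
  isqrt = primrec 0 λ k r → primrec (suc r) (λ _ _ → r) (suc r * suc r ∸ suc k)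

  isqrt-def : ∀ n → primrec 0 (λ k r → primrec (suc r) (λ _ _ → r) (suc r * suc r ∸ suc k)) n ≡ isqrt n
  isqrt-def n = refl

  isqrt-spec : ∀ n → isqrt n * isqrt n ≤ n × n < suc (isqrt n) * suc (isqrt n)
  isqrt-spec zero    = z≤n , s≤s z≤n
  isqrt-spec (suc n) with isqrt-spec n
  ... | lo , hi with suc (isqrt n) * suc (isqrt n) ∸ suc n in eq
  ...   | zero  = m∸n≡0⇒m≤n eq , (begin-strict
                    suc n                                       ≤⟨ hi ⟩
                    suc (isqrt n) * suc (isqrt n)
                      <⟨ *-mono-< (n<1+n (suc (isqrt n))) (n<1+n (suc (isqrt n))) ⟩
                    suc (suc (isqrt n)) * suc (suc (isqrt n))   ∎)
    where open ≤-Reasoning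
  ...   | suc d = m≤n⇒m≤1+n lo , ≰⇒> λ le → contradiction (trans (sym eq) (m≤n⇒m∸n≡0 le)) λ ()

  isqrt-unique : ∀ n m → m * m ≤ n → n < suc m * suc m → isqrt n ≡ m
  isqrt-unique n m lo hi = ≤-antisym
    (≮⇒≥ λ m<r → <⇒≱ hi (≤-trans (*-mono-≤ m<r m<r) (proj₁ (isqrt-spec n))))
    (≮⇒≥ λ r<m → <⇒≱ (proj₂ (isqrt-spec n)) (≤-trans (*-mono-≤ r<m r<m) lo))

  isqrt≤ : ∀ n → isqrt n ≤ n
  isqrt≤ n = ≤-trans (m≤m*m (isqrt n)) (proj₁ (isqrt-spec n))
    where
    m≤m*m : ∀ m → m ≤ m * m
    m≤m*m zero    = z≤n
    m≤m*m (suc m) = m≤m+n (suc m) _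

  -- As `b ≤ a + b`, the code lies below the next square, so its root recovers `a + b`. The pairing
  -- is injective but not surjective; on other numbers the truncation in `π₁` keeps both components
  -- small, see `π₁+π₂≤`.
  pair : ℕ → ℕ → ℕ
  pair a b = (a + b) * (a + b) + b

  π₂ π₁ : ℕ → ℕ
  π₂ n = n ∸ isqrt n * isqrt n
  π₁ n = isqrt n ∸ π₂ n

  pair-def : ∀ a b → (a + b) * (a + b) + b ≡ pair a b
  pair-def a b = refl

  π₂-def : ∀ n → n ∸ isqrt n * isqrt n ≡ π₂ n
  π₂-def n = refl

  π₁-def : ∀ n → isqrt n ∸ π₂ n ≡ π₁ n
  π₁-def n = refl

  private
    isqrt-pair : ∀ a b → isqrt (pair a b) ≡ a + b
    isqrt-pair a b = isqrt-unique _ (a + b) (m≤m+n _ b) (begin-strict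
      (a + b) * (a + b) + b           ≡⟨ +-comm _ b ⟩
      b + (a + b) * (a + b)           <⟨ +-mono-<-≤ (s≤s (m≤n+m b a)) (*-monoʳ-≤ (a + b) (n≤1+n _)) ⟩
      suc (a + b) * suc (a + b)       ∎)
      where open ≤-Reasoning

  π₂-pair : ∀ a b → π₂ (pair a b) ≡ b
  π₂-pair a b rewrite isqrt-pair a b = m+n∸m≡n ((a + b) * (a + b)) b

  π₁-pair : ∀ a b → π₁ (pair a b) ≡ a
  π₁-pair a b rewrite π₂-pair a b | isqrt-pair a b = m+n∸n≡m a b

  π₂-< : ∀ n → π₂ (suc n) < suc n
  π₂-< n with isqrt (suc n) | isqrt-spec (suc n)
  ... | zero  | _ , s≤s ()
  ... | suc r | _ = s≤s (m∸n≤m n (r + r * suc r))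

  π₂-0 : π₂ 0 ≡ 0
  π₂-0 = refl

  π₁+π₂≤ : ∀ n → π₁ n + π₂ n ≤ n
  π₁+π₂≤ n with ≤-total (isqrt n) (π₂ n)
  ... | inj₁ le rewrite m≤n⇒m∸n≡0 le = m∸n≤m n (isqrt n * isqrt n)
  ... | inj₂ le rewrite m∸n+n≡m le = isqrt≤ n

module _ {X : ℕ → ℕ} where

  isqrtF : Fun X 1
  isqrtF = define₁ isqrt
    (rec (var 0F) (lit 0)
       (ifz (succ (var 1F) ⊠ succ (var 1F) ⊟ succ (var 0F)) (succ (var 1F)) (var 3F)))
    isqrt-def

  pairF : Fun X 2
  pairF = define₂ pair ((var 0F ⊞ var 1F) ⊠ (var 0F ⊞ var 1F) ⊞ var 1F) pair-def

  π₂F π₁F : Fun X 1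
  π₂F = define₁ π₂ (var 0F ⊟ call₁ isqrtF (var 0F) ⊠ call₁ isqrtF (var 0F)) π₂-def
  π₁F = define₁ π₁ (call₁ isqrtF (var 0F) ⊟ call₁ π₂F (var 0F)) π₁-def

-- A universal machine

-- A number P codes the sequence coef P; as pair 0 0 ≡ 0 it is eventually zero.
drops : ℕ → ℕ → ℕ
drops P = primrec P (λ _ r → π₂ r)

coef : ℕ → ℕ → ℕ
coef P i = π₁ (drops P i)

drops-suc : ∀ P i → drops P (suc i) ≡ drops (π₂ P) i
drops-suc P zero    = refl
drops-suc P (suc i) = cong π₂ (drops-suc P i)

coef-suc : ∀ P i → coef P (suc i) ≡ coef (π₂ P) i
coef-suc P i = cong π₁ (drops-suc P i)

coef-pair-suc : ∀ a P i → coef (pair a P) (suc i) ≡ coef P i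
coef-pair-suc a P i = trans (coef-suc (pair a P) i) (cong (λ Q → coef Q i) (π₂-pair a P))

module _ {X : ℕ → ℕ} where

  ⌊_⌋ : ∀ {n} → Tm X n → Fun X n
  ⌊ t ⌋ = define ⟦ t ⟧ t (λ _ → refl)

  coefF : Fun X 2
  coefF = define₂ coef (call₁ π₁F (rec (var 1F) (var 0F) (call₁ π₂F (var 1F)))) (λ _ _ → refl)

  -- Nested uses peel off the tag one unit at a time while the other arguments stay in place; hence
  -- all rules of `ruleF` share the variables `pay`, `val` and `stk`.
  switch : ∀ {n} → Fun X n → Fun X (suc n) → Fun X (suc n)
  switch {n} F G = record { fn = f ; code = c ; correct = ok }
    where
    rest : Fin n → Code (2 + n)
    rest i = projᶜ (suc (suc i))
    c : Code (suc n)
    c = prec (code F) (comp (code G) (projᶜ 0F ∷ tabulate rest))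
    f : Vec ℕ (suc n) → ℕ
    f (zero  ∷ ρ) = fn F ρ
    f (suc k ∷ ρ) = fn G (k ∷ ρ)
    projs : ∀ {k y} (ρ : Vec ℕ n) i →
            X ⊢ lookup (projᶜ 0F ∷ tabulate rest) i [ k ∷ y ∷ ρ ]⇓ lookup (k ∷ ρ) i
    projs ρ zero    = ⇓-proj 0F
    projs ρ (suc i) = subst (λ p → X ⊢ p [ _ ]⇓ lookup ρ i) (sym (lookup∘tabulate rest i)) (⇓-proj (suc (suc i)))
    ok : ∀ xs → X ⊢ c [ xs ]⇓ f xs
    ok (zero  ∷ ρ) = ⇓-prec₀ (correct F ρ)
    ok (suc k ∷ ρ) = ⇓-precₛ (ok (k ∷ ρ)) (⇓-comp (projs ρ) (correct G (k ∷ ρ)))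

-- Since `pair 0 0` is 0, the successor is what distinguishes a nonempty stack from the empty stack
-- 0.
push : ℕ → ℕ → ℕ
push F K = suc (pair F K)

pushT : ∀ {X n} → Tm X n → Tm X n → Tm X n
pushT F K = succ (call₂ pairF F K)

-- A state pair V K consists of a value V and a stack K of frames, a frame being a number pair tag payload,
-- where tag is the position of the rule in ruleF.  Frames 4, 5, 8 and 10 are continuations: the remaining parts
-- of a tuple, and the pending steps of a primitive recursion and of a search.

module _ {X : ℕ → ℕ} where
  private
    pay val stk : Tm X 3
    pay = var 0F
    val = var 1F
    stk = var 2F

    _,,_ : ∀ {n} → Tm X n → Tm X n → Tm X n
    _,,_ = call₂ pairF
    infixr 5 _,,_

    1st 2nd : ∀ {n} → Tm X n → Tm X n
    1st = call₁ π₁F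
    2nd = call₁ π₂F

  zeroR sucR projR tupR tup₁R tup₂R compR precR precKR searchR muKR muR : Fun X 3
  zeroR   = ⌊ lit 0 ,, stk ⌋
  sucR    = ⌊ succ (1st val) ,, stk ⌋
  projR   = ⌊ call₂ coefF val pay ,, stk ⌋
  tupR    = ⌊ val ,, pushT (1st pay) (pushT (lit 4 ,, 2nd pay ,, val) stk) ⌋
  tup₁R   = ⌊ 2nd pay ,, pushT (1st pay) (pushT (lit 5 ,, val) stk) ⌋
  tup₂R   = ⌊ (pay ,, val) ,, stk ⌋
  compR   = ⌊ val ,, pushT (2nd pay) (pushT (1st pay) stk) ⌋
  -- The second branch of `ifz` binds two variables, so there `pay`, `val` and `stk` are the
  -- variables 2, 3 and 4. The same frame is pushed again for the predecessor, above a frame 8 that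
  -- will apply the step program.
  precR   = ⌊ ifz (1st val)
                (2nd val ,, pushT (1st pay) stk)
                ((var 0F ,, 2nd (var 3F)) ,,
                 pushT (lit 7 ,, var 2F)
                   (pushT (lit 8 ,, 2nd (var 2F) ,, var 0F ,, 2nd (var 3F)) (var 4F))) ⌋
  precKR  = ⌊ (1st (2nd pay) ,, val ,, 2nd (2nd pay)) ,, pushT (1st pay) stk ⌋
  searchR = ⌊ val ,, pushT pay (pushT (lit 10 ,, pay ,, val) stk) ⌋
  muKR    = ⌊ ifz val
                (1st (2nd pay) ,, stk)
                ((succ (1st (2nd (var 2F))) ,, 2nd (2nd (var 2F))) ,,
                 pushT (lit 9 ,, 1st (var 2F)) (var 4F)) ⌋
  muR     = ⌊ (lit 0 ,, val) ,, pushT (lit 9 ,, pay) stk ⌋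

  ruleF : Fun X 4
  ruleF = switch zeroR (switch sucR (switch projR (switch tupR (switch tup₁R (switch tup₂R
    (switch compR (switch precR (switch precKR (switch searchR (switch muKR (switch muR
    ⌊ lit 0 ⌋)))))))))))

rule : ℕ → ℕ → ℕ → ℕ → ℕ
rule tag payload V K = fn (ruleF {∅}) (tag ∷ payload ∷ V ∷ K ∷ [])

stepWith : (ℕ → ℕ → ℕ → ℕ → ℕ) → ℕ → ℕ
stepWith r S = primrec S (λ K _ → r (π₁ (π₁ K)) (π₂ (π₁ K)) (π₁ S) (π₂ K)) (π₂ S)

stepWith-halted : ∀ r S → π₂ S ≡ 0 → stepWith r S ≡ S
stepWith-halted r S eq rewrite eq = refl

stepWith-push : ∀ r V tag payload K → stepWith r (pair V (push (pair tag payload) K)) ≡ r tag payload V K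
stepWith-push r V tag payload K
  rewrite π₂-pair V (push (pair tag payload) K) | π₁-pair V (push (pair tag payload) K)
        | π₁-pair (pair tag payload) K | π₂-pair (pair tag payload) K
        | π₁-pair tag payload | π₂-pair tag payload = refl

opaque
  step : ℕ → ℕ
  step = stepWith rule

  step-def : ∀ S → stepWith rule S ≡ step S
  step-def S = refl

  step-halted : ∀ S → π₂ S ≡ 0 → step S ≡ S
  step-halted = stepWith-halted rule

  step-push : ∀ V tag payload K → step (pair V (push (pair tag payload) K)) ≡ rule tag payload V K
  step-push = stepWith-push rule

stepF : Fun ∅ 1
stepF = define₁ step
  (ifz (call₁ π₂F (var 0F)) (var 0F)
     (call ruleF (call₁ π₁F (call₁ π₁F (var 0F)) ∷ call₁ π₂F (call₁ π₁F (var 0F))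
                  ∷ call₁ π₁F (var 2F) ∷ call₁ π₂F (var 0F) ∷ [])))
  step-def

run : ℕ → ℕ → ℕ
run S = primrec S (λ _ → step)

-- Simulation of halting computations

mutual
  -- The tags are those of `ruleF`. The empty oracle answers 0, so `oracle` may share the code of
  -- `zeroᶜ`; so may the empty tuple of programs, as the empty vector has code 0.
  ⌜_⌝ᶜ : ∀ {n} → Code n → ℕ
  ⌜ zeroᶜ ⌝ᶜ    = pair 0 0
  ⌜ sucᶜ ⌝ᶜ     = pair 1 0
  ⌜ projᶜ i ⌝ᶜ  = pair 2 (toℕ i)
  ⌜ oracle ⌝ᶜ   = pair 0 0
  ⌜ comp p qs ⌝ᶜ = pair 6 (pair ⌜ p ⌝ᶜ ⌜ qs ⌝ᵛ)
  ⌜ prec p q ⌝ᶜ = pair 7 (pair ⌜ p ⌝ᶜ ⌜ q ⌝ᶜ)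
  ⌜ mu p ⌝ᶜ     = pair 11 ⌜ p ⌝ᶜ

  ⌜_⌝ᵛ : ∀ {n m} → Vec (Code n) m → ℕ
  ⌜ [] ⌝ᵛ     = pair 0 0
  ⌜ q ∷ qs ⌝ᵛ = pair 3 (pair ⌜ q ⌝ᶜ ⌜ qs ⌝ᵛ)

⌜_⌝ˣ : ∀ {n} → Vec ℕ n → ℕ
⌜ [] ⌝ˣ     = 0
⌜ x ∷ xs ⌝ˣ = pair x ⌜ xs ⌝ˣ

coef-⌜⌝ˣ : ∀ {n} (xs : Vec ℕ n) i → coef ⌜ xs ⌝ˣ (toℕ i) ≡ lookup xs i
coef-⌜⌝ˣ (x ∷ xs) zero    = π₁-pair x _
coef-⌜⌝ˣ (x ∷ xs) (suc i) = trans (coef-pair-suc x ⌜ xs ⌝ˣ (toℕ i)) (coef-⌜⌝ˣ xs i)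

infix 4 _↦*_
infixr 5 _◅_

data _↦*_ : ℕ → ℕ → Set where
  done : ∀ {S} → S ↦* S
  _◅_  : ∀ {S S′ S″} → step S ≡ S′ → S′ ↦* S″ → S ↦* S″

_◅◅_ : ∀ {S S′ S″} → S ↦* S′ → S′ ↦* S″ → S ↦* S″
done     ◅◅ d = d
(e ◅ c)  ◅◅ d = e ◅ (c ◅◅ d)
infixr 5 _◅◅_

fire : ∀ V tag payload K {S S′} → rule tag payload V K ≡ S → S ↦* S′ →
       pair V (push (pair tag payload) K) ↦* S′
fire V tag payload K eq c = trans (step-push V tag payload K) eq ◅ c

-- Quantifying over the rest `K` of the stack lets a subcomputation run on top of the pending frames
-- of the enclosing one.
Computes : ℕ → ℕ → ℕ → Set
Computes V F y = ∀ K → pair V (push F K) ↦* pair y K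

tuple-sim : ∀ {n m} (V : ℕ) (qs : Vec (Code n) m) (ys : Vec ℕ m) →
            (∀ i → Computes V ⌜ lookup qs i ⌝ᶜ (lookup ys i)) → Computes V ⌜ qs ⌝ᵛ ⌜ ys ⌝ˣ
tuple-sim V []       []       h K = fire V 0 0 K refl done
tuple-sim V (q ∷ qs) (y ∷ ys) h K =
  fire V 3 (pair ⌜ q ⌝ᶜ ⌜ qs ⌝ᵛ) K
    (cong₂ (λ f g → pair V (push f (push (pair 4 (pair g V)) K))) (π₁-pair _ _) (π₂-pair _ _)) (
  h zero (push (pair 4 (pair ⌜ qs ⌝ᵛ V)) K) ◅◅
  fire y 4 (pair ⌜ qs ⌝ᵛ V) K
    (cong₂ (λ f g → pair g (push f (push (pair 5 y) K))) (π₁-pair _ _) (π₂-pair _ _)) (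
  tuple-sim V qs ys (h ∘ suc) (push (pair 5 y) K) ◅◅
  fire ⌜ ys ⌝ˣ 5 y K refl done))

comp-sim : ∀ {V p q W y} → Computes V q W → Computes W p y → Computes V (pair 6 (pair p q)) y
comp-sim {V} {p} {q} {W} hq hp K =
  fire V 6 (pair p q) K
    (cong₂ (λ f g → pair V (push g (push f K))) (π₁-pair p q) (π₂-pair p q))
    (hq (push p K) ◅◅ hp K)

prec₀-sim : ∀ {p q V y} → Computes V p y → Computes (pair 0 V) (pair 7 (pair p q)) y
prec₀-sim {p} {q} {V} h K = fire (pair 0 V) 7 (pair p q) K eq (h K)
  where
  eq : rule 7 (pair p q) (pair 0 V) K ≡ pair V (push p K)
  eq rewrite π₁-pair 0 V | π₂-pair 0 V | π₁-pair p q = refl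

precₛ-sim : ∀ {p q k V y z} → Computes (pair k V) (pair 7 (pair p q)) y →
            Computes (pair k (pair y V)) q z → Computes (pair (suc k) V) (pair 7 (pair p q)) z
precₛ-sim {p} {q} {k} {V} {y} h₁ h₂ K =
  fire (pair (suc k) V) 7 (pair p q) K eq₁ (
  h₁ (push (pair 8 (pair q (pair k V))) K) ◅◅
  fire y 8 (pair q (pair k V)) K eq₂ (h₂ K))
  where
  eq₁ : rule 7 (pair p q) (pair (suc k) V) K ≡
        pair (pair k V) (push (pair 7 (pair p q)) (push (pair 8 (pair q (pair k V))) K))
  eq₁ rewrite π₁-pair (suc k) V | π₂-pair (suc k) V | π₂-pair p q = refl
  eq₂ : rule 8 (pair q (pair k V)) y K ≡ pair (pair k (pair y V)) (push q K)
  eq₂ rewrite π₁-pair q (pair k V) | π₂-pair q (pair k V) | π₁-pair k V | π₂-pair k V = refl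

module _ {p V y : ℕ} (nonzero : ∀ {i} → i < y → ∃ λ z → Computes (pair i V) p (suc z))
                 (zero-at : Computes (pair y V) p 0) where

  search-sim : ∀ d i → d + i ≡ y → Computes (pair i V) (pair 9 p) y
  search-sim zero i refl K =
    fire (pair i V) 9 p K refl (
    zero-at (push (pair 10 (pair p (pair i V))) K) ◅◅
    fire 0 10 (pair p (pair i V)) K eq done)
    where
    eq : rule 10 (pair p (pair i V)) 0 K ≡ pair i K
    eq rewrite π₂-pair p (pair i V) | π₁-pair i V = refl
  search-sim (suc d) i eq K with nonzero (subst (i <_) eq (s≤s (m≤n+m i d)))
  ... | z , h =
    fire (pair i V) 9 p K refl (
    h (push (pair 10 (pair p (pair i V))) K) ◅◅
    fire (suc z) 10 (pair p (pair i V)) K eq′ (search-sim d (suc i) (trans (+-suc d i) eq) K))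
    where
    eq′ : rule 10 (pair p (pair i V)) (suc z) K ≡ pair (pair (suc i) V) (push (pair 9 p) K)
    eq′ rewrite π₁-pair p (pair i V) | π₂-pair p (pair i V) | π₁-pair i V | π₂-pair i V = refl

  mu-sim : Computes V (pair 11 p) y
  mu-sim K = fire V 11 p K refl (search-sim y 0 (+-identityʳ y) K)

-- Recursion on the derivation. On programs without a value the machine may do anything: the weights
-- are defined from the machine itself, and an extension is constrained only where the program has a
-- value.
simulate : ∀ {n} {p : Code n} {xs y} → ∅ ⊢ p [ xs ]⇓ y → Computes ⌜ xs ⌝ˣ ⌜ p ⌝ᶜ y
simulate {xs = xs} ⇓-zero K = fire ⌜ xs ⌝ˣ 0 0 K refl done
simulate {xs = x ∷ []} ⇓-suc K = fire (pair x 0) 1 0 K (cong (λ v → pair (suc v) K) (π₁-pair x 0)) done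
simulate {xs = xs} (⇓-proj i) K =
  fire ⌜ xs ⌝ˣ 2 (toℕ i) K (cong (λ v → pair v K) (coef-⌜⌝ˣ xs i)) done
simulate {xs = xs} ⇓-oracle K = fire ⌜ xs ⌝ˣ 0 0 K refl done
simulate {xs = xs} (⇓-comp {qs = qs} {ys = ys} ds d) =
  comp-sim (tuple-sim ⌜ xs ⌝ˣ qs ys (λ i → simulate (ds i))) (simulate d)
simulate (⇓-prec₀ d) = prec₀-sim (simulate d)
simulate (⇓-precₛ d e) = precₛ-sim (simulate d) (simulate e)
simulate (⇓-mu h d) = mu-sim (λ i<y → proj₁ (h i<y) , simulate (proj₂ (h i<y))) (simulate d)

↦*⇒run : ∀ {S S′} → S ↦* S′ → ∃ λ t → run S t ≡ S′
↦*⇒run done    = 0 , refl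
↦*⇒run {S} (refl ◅ c) with ↦*⇒run c
... | t , eq = suc t , trans (run-suc t) eq
  where
  run-suc : ∀ t → run S (suc t) ≡ run (step S) t
  run-suc zero    = refl
  run-suc (suc t) = cong step (run-suc t)

result : ℕ → ℕ
result S = primrec (suc (π₁ S)) (λ _ _ → 0) (π₂ S)

initial : ℕ → ℕ
initial i = pair (pair (π₂ (π₂ i)) 0) (push (π₁ (π₂ i)) 0)

result≡suc⇒halted : ∀ S {y} → result S ≡ suc y → π₂ S ≡ 0
result≡suc⇒halted S eq with π₂ S
... | zero = refl
... | suc _ with () ← eq

run-halted : ∀ S t d {y} → result (run S t) ≡ suc y → result (run S (d + t)) ≡ suc y
run-halted S t zero    eq = eq
run-halted S t (suc d) eq =
  trans (cong result (step-halted (run S (d + t)) (result≡suc⇒halted (run S (d + t)) ih))) ih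
  where ih = run-halted S t d eq

opaque
  -- output i t is suc y if the program i halts with output y within t steps, and 0 if it is still running;
  -- i is pair m (pair p x), for the program p on input x and an arbitrary m.
  output : ℕ → ℕ → ℕ
  output i t = result (run (initial i) t)

  output-def : ∀ i t → result (run (initial i) t) ≡ output i t
  output-def i t = refl

  output-exists : ∀ {p : Code 1} {x y} m → ∅ ⊢ p [ x ∷ [] ]⇓ y →
                  ∃ λ t → output (pair m (pair ⌜ p ⌝ᶜ x)) t ≡ suc y
  output-exists {p} {x} {y} m d with ↦*⇒run (simulate d 0)
  ... | t , eq = t , trans (cong result (trans (cong (λ S → run S t) initial≡) eq)) result≡
    where
    initial≡ : initial (pair m (pair ⌜ p ⌝ᶜ x)) ≡ pair (pair x 0) (push ⌜ p ⌝ᶜ 0)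
    initial≡ rewrite π₂-pair m (pair ⌜ p ⌝ᶜ x) | π₂-pair ⌜ p ⌝ᶜ x | π₁-pair ⌜ p ⌝ᶜ x = refl
    result≡ : result (pair y 0) ≡ suc y
    result≡ rewrite π₂-pair y 0 | π₁-pair y 0 = refl

  output-later : ∀ i {t t′ y} → t ≤ t′ → output i t ≡ suc y → output i t′ ≡ suc y
  output-later i {t} {t′} t≤t′ h =
    subst (λ u → output i u ≡ _) (m∸n+n≡m t≤t′) (run-halted (initial i) t (t′ ∸ t) h)

  output-unique : ∀ i t t′ {y y′} → output i t ≡ suc y → output i t′ ≡ suc y′ → y ≡ y′
  output-unique i t t′ h h′ with ≤-total t t′
  ... | inj₁ t≤t′ = suc-injective (trans (sym (output-later i t≤t′ h)) h′)
  ... | inj₂ t′≤t = suc-injective (trans (sym h) (output-later i t′≤t h′))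

outputF : Fun ∅ 2
outputF = define₂ output
  (call (define₁ result (ifz (call₁ π₂F (var 0F)) (succ (call₁ π₁F (var 0F))) (lit 0)) (λ _ → refl))
     (rec (var 1F)
        (call₂ pairF (call₂ pairF (call₁ π₂F (call₁ π₂F (var 0F))) (lit 0))
                     (pushT (call₁ π₁F (call₁ π₂F (var 0F))) (lit 0)))
        (call₁ stepF (var 1F)) ∷ []))
  output-def

-- Groups presented by numberings

mutual
  -- A program for the oracle `∅` may still query it. Replacing each query by its answer 0 makes the
  -- program work with every oracle, as is needed when a program with the colouring as oracle calls
  -- `elementF`.
  oracleFree : ∀ {n} → Code n → Code n
  oracleFree zeroᶜ       = zeroᶜ
  oracleFree sucᶜ        = sucᶜ
  oracleFree (projᶜ i)   = projᶜ i
  oracleFree oracle      = zeroᶜ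
  oracleFree (comp p qs) = comp (oracleFree p) (oracleFree* qs)
  oracleFree (prec p q)  = prec (oracleFree p) (oracleFree q)
  oracleFree (mu p)      = mu (oracleFree p)

  oracleFree* : ∀ {n m} → Vec (Code n) m → Vec (Code n) m
  oracleFree* []       = []
  oracleFree* (q ∷ qs) = oracleFree q ∷ oracleFree* qs

lookup-oracleFree* : ∀ {n m} (qs : Vec (Code n) m) i → lookup (oracleFree* qs) i ≡ oracleFree (lookup qs i)
lookup-oracleFree* (q ∷ qs) zero    = refl
lookup-oracleFree* (q ∷ qs) (suc i) = lookup-oracleFree* qs i

oracleFree-correct : ∀ {X n} {p : Code n} {xs y} → ∅ ⊢ p [ xs ]⇓ y → X ⊢ oracleFree p [ xs ]⇓ y
oracleFree-correct ⇓-zero = ⇓-zero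
oracleFree-correct ⇓-suc = ⇓-suc
oracleFree-correct (⇓-proj i) = ⇓-proj i
oracleFree-correct ⇓-oracle = ⇓-zero
oracleFree-correct {X} (⇓-comp {qs = qs} {xs} {ys} ds d) = ⇓-comp
  (λ i → subst (λ q → X ⊢ q [ xs ]⇓ lookup ys i) (sym (lookup-oracleFree* qs i)) (oracleFree-correct (ds i)))
  (oracleFree-correct d)
oracleFree-correct (⇓-prec₀ d) = ⇓-prec₀ (oracleFree-correct d)
oracleFree-correct (⇓-precₛ d e) = ⇓-precₛ (oracleFree-correct d) (oracleFree-correct e)
oracleFree-correct (⇓-mu h d) =
  ⇓-mu (λ i<y → proj₁ (h i<y) , oracleFree-correct (proj₂ (h i<y))) (oracleFree-correct d)

relativise : ∀ {X n} → Fun ∅ n → Fun X n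
relativise F = record { fn = fn F ; code = oracleFree (code F) ; correct = oracleFree-correct ∘ correct F }

IsLeastZero : (ℕ → ℕ) → ℕ → Set
IsLeastZero t m = t m ≡ 0 × (∀ {i} → i < m → t i ≢ 0)

opaque
  leastZero : (t : ℕ → ℕ) → ∃ (λ n → t n ≡ 0) → ∃ (IsLeastZero t)
  leastZero t (n , tn≡0) with below (suc n)
    where
    below : ∀ n → ∃ (IsLeastZero t) ⊎ (∀ {i} → i < n → t i ≢ 0)
    below zero = inj₂ λ ()
    below (suc n) with below n
    ... | inj₁ found = inj₁ found
    ... | inj₂ none with t n in eq
    ...   | zero  = inj₁ (n , eq , none)
    ...   | suc _ = inj₂ λ {i} i<1+n → below-suc (m≤n⇒m<n∨m≡n (≤-pred i<1+n))
      where
      below-suc : ∀ {i} → i < n ⊎ i ≡ n → t i ≢ 0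
      below-suc (inj₁ i<n)  = none i<n
      below-suc (inj₂ refl) ti≡0 with () ← trans (sym eq) ti≡0
  ... | inj₁ found = found
  ... | inj₂ none  = contradiction tn≡0 (none (n<1+n n))

-- One ternary test is all that has to be decided: with second argument 0 it is equality, and sums
-- and inverses are found by search, which ends because of the last two fields.
record Numbering (Γ : AbelianGroup 0ℓ 0ℓ) : Set where
  open AbelianGroup Γ
  field
    φ             : ℕ → Carrier
    testF         : Fun ∅ 3

  test : ℕ → ℕ → ℕ → ℕ
  test x y z = fn testF (x ∷ y ∷ z ∷ [])

  field
    test-sound    : ∀ x y z → test x y z ≡ 0 → φ x ∙ φ y ≈ φ z
    test-complete : ∀ x y z → φ x ∙ φ y ≈ φ z → test x y z ≡ 0
    φ-0           : φ 0 ≈ ε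
    sum-code      : ∀ x y → ∃ λ z → φ x ∙ φ y ≈ φ z
    inverse-code  : ∀ x → ∃ λ z → φ x ∙ φ z ≈ ε

-- G is, up to isomorphism, the subgroup φ(ℕ) of Γ.
record Realises (Γ : AbelianGroup 0ℓ 0ℓ) (φ : ℕ → AbelianGroup.Carrier Γ) (G : ComputableAbelianGroup) : Set where
  open AbelianGroup Γ using (_≈_; _∙_; ε)
  open ComputableAbelianGroup G using (Carrier; _⊕_; 0#)
  field
    ⟪_⟫           : Carrier → AbelianGroup.Carrier Γ
    ⟪⟫-injective  : ∀ {x y} → ⟪ x ⟫ ≈ ⟪ y ⟫ → x ≡ y
    ⟪⊕⟫           : ∀ x y → ⟪ x ⊕ y ⟫ ≈ ⟪ x ⟫ ∙ ⟪ y ⟫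
    ⟪0⟫           : ⟪ 0# ⟫ ≈ ε
    element       : ℕ → Carrier
    ⟪element⟫     : ∀ n → ⟪ element n ⟫ ≈ φ n
    elementF      : Fun ∅ 1
    fn-elementF   : ∀ n → fn elementF (n ∷ []) ≡ proj₁ (element n)

-- The subgroup φ(ℕ) of Γ, each element being represented by its least number.
module LeastNumbers {Γ : AbelianGroup 0ℓ 0ℓ} (N : Numbering Γ) where
  open AbelianGroup Γ
    renaming (Carrier to C; refl to ≈-refl; sym to ≈-sym; trans to ≈-trans; assoc to ∙-assoc; comm to ∙-comm)
  open Numbering N
  open GroupProperties group using (inverseʳ-unique)

  same-sound : ∀ x y → test x 0 y ≡ 0 → φ x ≈ φ y
  same-sound x y h = ≈-trans (≈-sym (≈-trans (∙-congˡ φ-0) (identityʳ (φ x)))) (test-sound x 0 y h)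

  same-complete : ∀ x y → φ x ≈ φ y → test x 0 y ≡ 0
  same-complete x y h = test-complete x 0 y (≈-trans (≈-trans (∙-congˡ φ-0) (identityʳ (φ x))) h)

  smaller : ℕ → ℕ
  smaller x = ∑< x (λ y → 1 ∸ test y 0 x)

  isZero : ℕ → Bool
  isZero zero    = true
  isZero (suc _) = false

  dom : ℕ → Bool
  dom x = isZero (smaller x)

  bit-isZero : ∀ n → 1 ∸ n ≡ bit (isZero n)
  bit-isZero zero    = refl
  bit-isZero (suc n) = 0∸n≡0 n

  domF : Fun ∅ 1
  domF = define₁ (bit ∘ dom)
    (lit 1 ⊟ sumTo (var 0F) (lit 1 ⊟ call₃ testF (var 0F) (lit 0) (var 2F)))
    (λ x → bit-isZero (smaller x))

  Elem : Set
  Elem = ∃ (T ∘ dom)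

  Least : ℕ → Set
  Least x = ∀ {y} → y < x → ¬ φ y ≈ φ x

  isZero⇒ : ∀ n → T (isZero n) → n ≡ 0
  isZero⇒ zero _ = refl

  dom⇒Least : ∀ {x} → T (dom x) → Least x
  dom⇒Least {x} d {y} y<x φy≈φx with () ←
    trans (sym (cong (1 ∸_) (same-complete y x φy≈φx))) (∑<-≡0 x (isZero⇒ _ d) y y<x)

  Least⇒dom : ∀ {x} → Least x → T (dom x)
  Least⇒dom {x} least = subst (T ∘ isZero) (sym (∑<-0 x vanish)) _
    where
    vanish : ∀ y → y < x → 1 ∸ test y 0 x ≡ 0
    vanish y y<x with test y 0 x in eq
    ... | zero  = contradiction (same-sound y x eq) (least y<x)
    ... | suc n = 0∸n≡0 n

  ⟪_⟫ : Elem → C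
  ⟪ x ⟫ = φ (proj₁ x)

  ⟪⟫-injective : ∀ {x y} → ⟪ x ⟫ ≈ ⟪ y ⟫ → x ≡ y
  ⟪⟫-injective {x , dx} {y , dy} eq with
    ≤-antisym (≮⇒≥ λ y<x → dom⇒Least {x} dx y<x (≈-sym eq)) (≮⇒≥ λ x<y → dom⇒Least {y} dy x<y eq)
  ... | refl = cong (x ,_) (T-irrelevant dx dy)

  -- The least number passing the test for `g` is also the least number of `g`, hence in the domain.
  -- Sums, inverses and representatives are instances.
  module Pick (t : ℕ → ℕ) (g : C) (sound : ∀ z → t z ≡ 0 → g ≈ φ z) (complete : ∀ z → g ≈ φ z → t z ≡ 0)
              (code : ∃ λ z → g ≈ φ z) where

    private
      found : ∃ (IsLeastZero t)
      found = leastZero t (proj₁ code , complete _ (proj₂ code))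

    number : ℕ
    number = proj₁ found

    number-zero : t number ≡ 0
    number-zero = proj₁ (proj₂ found)

    number-least : ∀ {i} → i < number → t i ≢ 0
    number-least = proj₂ (proj₂ found)

    elem : Elem
    elem = number , Least⇒dom (λ {y} y<n φy≈ → number-least y<n
      (complete y (≈-trans (sound number number-zero) (≈-sym φy≈))))

    elem-value : ⟪ elem ⟫ ≈ g
    elem-value = ≈-sym (sound number number-zero)

  module Sum (x y : ℕ) = Pick (test x y) (φ x ∙ φ y) (test-sound x y) (test-complete x y) (sum-code x y)

  inverse-sound : ∀ x z → test x z 0 ≡ 0 → φ x ⁻¹ ≈ φ z
  inverse-sound x z h = ≈-sym (inverseʳ-unique (φ x) (φ z) (≈-trans (test-sound x z 0 h) φ-0))

  inverse-complete : ∀ x z → φ x ⁻¹ ≈ φ z → test x z 0 ≡ 0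
  inverse-complete x z h = test-complete x z 0
    (≈-trans (∙-congˡ (≈-sym h)) (≈-trans (inverseʳ (φ x)) (≈-sym φ-0)))

  module Inverse (x : ℕ) = Pick (λ z → test x z 0) (φ x ⁻¹) (inverse-sound x) (inverse-complete x)
    (proj₁ (inverse-code x) , ≈-sym (inverseʳ-unique (φ x) _ (proj₂ (inverse-code x))))

  module Canonical (x : ℕ) = Pick (test x 0) (φ x) (same-sound x) (same-complete x) (x , ≈-refl)

  infixl 6 _⊕_
  _⊕_ : Elem → Elem → Elem
  x ⊕ y = Sum.elem (proj₁ x) (proj₁ y)

  ⊝_ : Elem → Elem
  ⊝ x = Inverse.elem (proj₁ x)

  canonical : ℕ → Elem
  canonical = Canonical.elem

  ⟪⊕⟫ : ∀ x y → ⟪ x ⊕ y ⟫ ≈ ⟪ x ⟫ ∙ ⟪ y ⟫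
  ⟪⊕⟫ x y = Sum.elem-value (proj₁ x) (proj₁ y)

  ⟪⊝⟫ : ∀ x → ⟪ ⊝ x ⟫ ≈ ⟪ x ⟫ ⁻¹
  ⟪⊝⟫ x = Inverse.elem-value (proj₁ x)

  ⟪canonical⟫ : ∀ n → ⟪ canonical n ⟫ ≈ φ n
  ⟪canonical⟫ = Canonical.elem-value

  0ᴳ : Elem
  0ᴳ = canonical 0

  ⟪0⟫ : ⟪ 0ᴳ ⟫ ≈ ε
  ⟪0⟫ = ≈-trans (⟪canonical⟫ 0) φ-0

  -- This law and those that follow are pulled back from `Γ` along the injection `⟪_⟫`.
  ⊕-assoc : ∀ x y z → (x ⊕ y) ⊕ z ≡ x ⊕ (y ⊕ z)
  ⊕-assoc x y z = ⟪⟫-injective (≈-trans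
    (≈-trans (⟪⊕⟫ (x ⊕ y) z) (∙-congʳ (⟪⊕⟫ x y))) (≈-trans (∙-assoc ⟪ x ⟫ ⟪ y ⟫ ⟪ z ⟫)
    (≈-sym (≈-trans (⟪⊕⟫ x (y ⊕ z)) (∙-congˡ (⟪⊕⟫ y z))))))

  ⊕-comm : ∀ x y → x ⊕ y ≡ y ⊕ x
  ⊕-comm x y = ⟪⟫-injective (≈-trans (⟪⊕⟫ x y) (≈-trans (∙-comm ⟪ x ⟫ ⟪ y ⟫) (≈-sym (⟪⊕⟫ y x))))

  ⊕-identityˡ : ∀ x → 0ᴳ ⊕ x ≡ x
  ⊕-identityˡ x = ⟪⟫-injective (≈-trans (⟪⊕⟫ 0ᴳ x) (≈-trans (∙-congʳ ⟪0⟫) (identityˡ ⟪ x ⟫)))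

  ⊕-inverseˡ : ∀ x → (⊝ x) ⊕ x ≡ 0ᴳ
  ⊕-inverseˡ x = ⟪⟫-injective (≈-trans (⟪⊕⟫ (⊝ x) x)
    (≈-trans (∙-congʳ (⟪⊝⟫ x)) (≈-trans (inverseˡ ⟪ x ⟫) (≈-sym ⟪0⟫))))

  ⊕-isAbelianGroup : IsAbelianGroup _≡_ _⊕_ 0ᴳ ⊝_
  ⊕-isAbelianGroup = record
    { isGroup = record
      { isMonoid = record
        { isSemigroup = record
          { isMagma = record { isEquivalence = Eq.isEquivalence ; ∙-cong = cong₂ _⊕_ }
          ; assoc = ⊕-assoc }
        ; identity = ⊕-identityˡ , λ x → trans (⊕-comm x 0ᴳ) (⊕-identityˡ x) }
      ; inverse = ⊕-inverseˡ , λ x → trans (⊕-comm x (⊝ x)) (⊕-inverseˡ x)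
      ; ⁻¹-cong = cong ⊝_ }
    ; comm = ⊕-comm }

  sumF : Fun ∅ 2
  sumF = minimise ⌊ call₃ testF (var 1F) (var 2F) (var 0F) ⌋ (uncurry₂ Sum.number)
    (λ { (x ∷ y ∷ []) → Sum.number-zero x y }) (λ { (x ∷ y ∷ []) → Sum.number-least x y })

  inverseF : Fun ∅ 1
  inverseF = minimise ⌊ call₃ testF (var 1F) (var 0F) (lit 0) ⌋ (uncurry₁ Inverse.number)
    (λ { (x ∷ []) → Inverse.number-zero x }) (λ { (x ∷ []) → Inverse.number-least x })

  canonicalF : Fun ∅ 1
  canonicalF = minimise ⌊ call₃ testF (var 1F) (lit 0) (var 0F) ⌋ (uncurry₁ Canonical.number)
    (λ { (x ∷ []) → Canonical.number-zero x }) (λ { (x ∷ []) → Canonical.number-least x })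

  computableGroup : ComputableAbelianGroup
  computableGroup = record
    { dom            = dom
    ; dom-computable = code domF , λ x → correct domF (x ∷ [])
    ; _⊕_            = _⊕_
    ; 0#             = 0ᴳ
    ; ⊖_             = ⊝_
    ; isAbelianGroup = ⊕-isAbelianGroup
    ; ⊕-computable   = code sumF , λ x y → correct sumF (proj₁ x ∷ proj₁ y ∷ [])
    ; ⊖-computable   = code inverseF , λ x → correct inverseF (proj₁ x ∷ [])
    }

  realises : Realises Γ φ computableGroup
  realises = record
    { ⟪_⟫          = ⟪_⟫
    ; ⟪⟫-injective = ⟪⟫-injective
    ; ⟪⊕⟫          = ⟪⊕⟫
    ; ⟪0⟫          = ⟪0⟫
    ; element      = canonical
    ; ⟪element⟫    = ⟪canonical⟫
    ; elementF     = canonicalF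
    ; fn-elementF  = λ _ → refl
    }

-- Weights of the generators

π₁≤ : ∀ n → π₁ n ≤ n
π₁≤ n = ≤-trans (m≤m+n _ _) (π₁+π₂≤ n)

π₂≤ : ∀ n → π₂ n ≤ n
π₂≤ n = ≤-trans (m≤n+m _ (π₁ n)) (π₁+π₂≤ n)

-- By `π₂-<` the tail of a positive code is strictly smaller, so nothing is left after `P` steps.
coef-support : ∀ i P → P ≤ i → coef P i ≡ 0
coef-support zero    zero _   = n≤0⇒n≡0 (π₁≤ 0)
coef-support (suc i) P    P≤i = trans (coef-suc P i) (coef-support i (π₂ P) (shrink P P≤i))
  where
  shrink : ∀ P → P ≤ suc i → π₂ P ≤ i
  shrink zero    _         = subst (_≤ i) (sym π₂-0) z≤n
  shrink (suc P) (s≤s P≤i) = ≤-trans (≤-pred (π₂-< P)) P≤i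

∑<-suc : ∀ n f → ∑< (suc n) f ≡ f 0 + ∑< n (f ∘ suc)
∑<-suc zero    f = +-comm 0 (f 0)
∑<-suc (suc n) f = trans (cong (_+ f (suc n)) (∑<-suc n f)) (+-assoc (f 0) _ _)

∑<-+ : ∀ n f g → ∑< n (λ i → f i + g i) ≡ ∑< n f + ∑< n g
∑<-+ zero    f g = refl
∑<-+ (suc n) f g rewrite ∑<-+ n f g = interchange (∑< n f) (∑< n g) (f n) (g n)
  where
  interchange : ∀ a b c d → a + b + (c + d) ≡ a + c + (b + d)
  interchange = solve-∀

∑<-* : ∀ n k f → ∑< n (λ i → k * f i) ≡ k * ∑< n f
∑<-* zero    k f = sym (*-zeroʳ k)
∑<-* (suc n) k f rewrite ∑<-* n k f = sym (*-distribˡ-+ k _ _)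

∑<-mono : ∀ n {f g : ℕ → ℕ} → (∀ i → f i ≤ g i) → ∑< n f ≤ ∑< n g
∑<-mono zero    h = z≤n
∑<-mono (suc n) h = +-mono-≤ (∑<-mono n h) (h n)

coef-sum : ∀ n P → ∑< n (coef P) ≤ P
coef-sum zero    P = z≤n
coef-sum (suc n) P = begin
  ∑< (suc n) (coef P)             ≡⟨ ∑<-suc n (coef P) ⟩
  π₁ P + ∑< n (coef P ∘ suc)      ≡⟨ cong (_+_ (π₁ P)) (∑<-cong n (λ i _ → coef-suc P i)) ⟩
  π₁ P + ∑< n (coef (π₂ P))       ≤⟨ +-monoʳ-≤ (π₁ P) (coef-sum n (π₂ P)) ⟩
  π₁ P + π₂ P                     ≤⟨ π₁+π₂≤ P ⟩
  P                               ∎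
  where open ≤-Reasoning

encode : (ℕ → ℕ) → ℕ → ℕ
encode f zero    = 0
encode f (suc n) = pair (f 0) (encode (f ∘ suc) n)

coef-encode : ∀ n f → (∀ i → n ≤ i → f i ≡ 0) → ∀ i → coef (encode f n) i ≡ f i
coef-encode zero    f h i       = trans (coef-support i 0 z≤n) (sym (h i z≤n))
coef-encode (suc n) f h zero    = π₁-pair (f 0) _
coef-encode (suc n) f h (suc i) =
  trans (coef-pair-suc (f 0) _ i) (coef-encode n (f ∘ suc) (λ j n≤j → h (suc j) (s≤s n≤j)) i)

-- The two ways in which the size of a code limits a combination: a sum over the indices below `B`
-- misses nothing, and the coefficients are too small to compete with a weight that is chosen at
-- stage `B` or later.
record Bounded (B : ℕ) (f : ℕ → ℕ) : Set where
  constructor bounded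
  field
    support : ∀ {i} → B ≤ i → f i ≡ 0
    total   : ∀ n → ∑< n f ≤ B

open Bounded

coef-bounded : ∀ P {B} → P ≤ B → Bounded B (coef P)
coef-bounded P P≤B = bounded (λ {i} B≤i → coef-support i P (≤-trans P≤B B≤i)) (λ n → ≤-trans (coef-sum n P) P≤B)

+-bounded : ∀ {A B f g} → Bounded A f → Bounded B g → Bounded (A + B) (λ i → f i + g i)
+-bounded {A} {B} {f} {g} bf bg = bounded
  (λ le → cong₂ _+_ (support bf (≤-trans (m≤m+n A B) le)) (support bg (≤-trans (m≤n+m B A) le)))
  (λ n → subst (_≤ A + B) (sym (∑<-+ n f g)) (+-mono-≤ (total bf n) (total bg n)))

-- The generator i equals weight i s times b once the weight is nonzero; the generator 0 is b itself.
-- Only the weight of π₁ s can change at stage s, so that relations appear one at a time.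

value : ℕ → ℕ → ℕ
value s y = (2 + s) ! + (1 ∸ (1 ∸ y))

-- The second argument is an `output`, the third the distance to the generator whose turn it is. The
-- result 0 announces nothing: the program still runs, or it is another generator's turn. Outputs
-- above 1 are treated by `value` like 1.
announce : ℕ → ℕ → ℕ → ℕ
announce s d = primrec (primrec 0 (λ y _ → value s y) d) (λ _ _ → 0)

update : ℕ → ℕ → ℕ
update a r = primrec a (λ _ _ → r) r

opaque
  -- Every generator `i` is inspected with every number `t` of steps, namely at stage `pair i t`, so
  -- each halting program is noticed. By `update` a nonzero weight is final.
  weight : ℕ → ℕ → ℕ
  weight i = primrec (1 ∸ i) (λ s → update (announce s (output i (π₂ s)) (dist (π₁ s) i)))

  weight-def : ∀ i s →
               primrec (1 ∸ i) (λ s → update (announce s (output i (π₂ s)) (dist (π₁ s) i))) s ≡ weight i s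
  weight-def i s = refl

  weight-suc : ∀ i s → weight i (suc s) ≡ update (announce s (output i (π₂ s)) (dist (π₁ s) i)) (weight i s)
  weight-suc i s = refl

  weight-start : ∀ i → weight i 0 ≡ 1 ∸ i
  weight-start i = refl

data Change (i s : ℕ) : Set where
  same  : weight i (suc s) ≡ weight i s → Change i s
  fresh : ∀ {y} → π₁ s ≡ i → weight i s ≡ 0 → output i (π₂ s) ≡ suc y →
          weight i (suc s) ≡ value s y → Change i s

change : ∀ i s → Change i s
change i s with weight i s in w≡
... | suc _ = same (trans (weight-suc i s) (trans (cong (update _) w≡) (sym w≡)))
... | zero  with trans (weight-suc i s) (cong (update _) w≡)
                 | dist (π₁ s) i in d≡ | output i (π₂ s) in o≡
...   | eq | suc _ | o     = same (trans eq (trans (cong (announce s (output i (π₂ s))) d≡) (sym w≡)))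
...   | eq | zero  | zero  = same (trans eq (trans (cong₂ (announce s) o≡ d≡) (sym w≡)))
...   | eq | zero  | suc y = fresh (dist≡0⇒≡ (π₁ s) i d≡) w≡ o≡ (trans eq (cong₂ (announce s) o≡ d≡))

announce-fresh : ∀ {s i o} → π₁ s ≡ i → ∀ {y} → o ≡ suc y → announce s o (dist (π₁ s) i) ≡ value s y
announce-fresh {s} refl refl rewrite dist-self (π₁ s) = refl

weight-fresh : ∀ {i s y} → π₁ s ≡ i → weight i s ≡ 0 → output i (π₂ s) ≡ suc y → weight i (suc s) ≡ value s y
weight-fresh {i} {s} π₁≡ w≡ o≡ =
  trans (weight-suc i s) (trans (cong (update _) w≡) (announce-fresh π₁≡ o≡))

weight-stable : ∀ i s → weight i s ≢ 0 → weight i (suc s) ≡ weight i s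
weight-stable i s ≢0 with change i s
... | same eq = eq
... | fresh _ ≡0 _ _ = contradiction ≡0 ≢0

weight-≤ : ∀ i s → weight i s ≤ suc ((1 + s) !)
weight-≤ i zero    = subst (_≤ 2) (sym (weight-start i)) (≤-trans (m∸n≤m 1 i) (s≤s z≤n))
weight-≤ i (suc s) with change i s
... | same eq = subst (_≤ suc ((2 + s) !)) (sym eq)
      (≤-trans (weight-≤ i s) (s≤s (m≤m+n ((1 + s) !) _)))
... | fresh {y} _ _ _ eq = subst (_≤ suc ((2 + s) !)) (sym eq)
      (≤-trans (+-monoʳ-≤ ((2 + s) !) (m∸n≤m 1 (1 ∸ y))) (≤-reflexive (+-comm ((2 + s) !) 1)))

weight-0 : ∀ s → weight 0 s ≡ 1
weight-0 zero    = weight-start 0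
weight-0 (suc s) = trans (weight-stable 0 s λ ≡0 → contradiction (trans (sym (weight-0 s)) ≡0) λ ()) (weight-0 s)

weight-persists : ∀ i s d → weight i s ≢ 0 → weight i (d + s) ≡ weight i s
weight-persists i s zero    ≢0 = refl
weight-persists i s (suc d) ≢0 = trans
  (weight-stable i (d + s) (≢0 ∘ trans (sym (weight-persists i s d ≢0)))) (weight-persists i s d ≢0)

-- Coordinates at stage `s` in the free abelian group on b and the generators that are still free:
-- coordinate 0 collects the multiples of b contributed by the generators already tied, and
-- coordinate `suc i` is the coefficient of the generator `i` as long as its weight is 0.
functional : ℕ → ℕ → (ℕ → ℕ) → ℕ
functional s zero    f = ∑< s (λ i → weight i s * f i)
functional s (suc i) f = (1 ∸ weight i s) * f i

functional-cong : ∀ s j {f g : ℕ → ℕ} → (∀ i → f i ≡ g i) → functional s j f ≡ functional s j g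
functional-cong s zero    h = ∑<-cong s (λ i _ → cong (weight i s *_) (h i))
functional-cong s (suc i) h = cong ((1 ∸ weight i s) *_) (h i)

functional-+ : ∀ s j f g → functional s j (λ i → f i + g i) ≡ functional s j f + functional s j g
functional-+ s zero    f g = trans (∑<-cong s (λ i _ → *-distribˡ-+ (weight i s) (f i) (g i))) (∑<-+ s _ _)
functional-+ s (suc i) f g = *-distribˡ-+ (1 ∸ weight i s) (f i) (g i)

Agree : ℕ → (ℕ → ℕ) → (ℕ → ℕ) → Set
Agree s f g = ∀ j → functional s j f ≡ functional s j g

opaque
  increase : ℕ → ℕ
  increase s = weight (π₁ s) (suc s) ∸ weight (π₁ s) s

  weight-increase : ∀ s → weight (π₁ s) (suc s) ≡ weight (π₁ s) s + increase s
  weight-increase s with change (π₁ s) s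
  ... | same eq rewrite eq | n∸n≡0 (weight (π₁ s) s) = sym (+-identityʳ _)
  ... | fresh _ ≡0 _ eq rewrite ≡0 = refl

  weight-other : ∀ i s → i ≢ π₁ s → weight i (suc s) ≡ weight i s
  weight-other i s i≢ with change i s
  ... | same eq = eq
  ... | fresh ≡i _ _ _ = contradiction (sym ≡i) i≢

  increase-cases : ∀ s → increase s ≡ 0 ⊎ (weight (π₁ s) s ≡ 0 × (2 + s) ! ≤ increase s)
  increase-cases s with change (π₁ s) s
  ... | same eq = inj₁ (trans (cong (_∸ weight (π₁ s) s) eq) (n∸n≡0 (weight (π₁ s) s)))
  ... | fresh _ ≡0 _ eq rewrite eq | ≡0 = inj₂ (refl , m≤m+n _ _)

weight-changes : ∀ i s → weight i (suc s) ≡ weight i s ⊎ (i ≡ π₁ s × NonZero (increase s))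
weight-changes i s with i ≟ π₁ s | increase-cases s
... | no i≢    | _                = inj₁ (weight-other i s i≢)
... | yes refl | inj₁ δ≡0        = inj₁ (trans (weight-increase s)
                                    (trans (cong (weight i s +_) δ≡0) (+-identityʳ _)))
... | yes refl | inj₂ (_ , δ≥)   = inj₂ (refl , >-nonZero (<-≤-trans (1≤n! (2 + s)) δ≥))

∑<-perturb : ∀ n {e δ} {a b : ℕ → ℕ} (f : ℕ → ℕ) → e < n → (∀ i → i ≢ e → b i ≡ a i) → b e ≡ a e + δ →
             ∑< n (λ i → b i * f i) ≡ ∑< n (λ i → a i * f i) + δ * f e
∑<-perturb (suc n) {e} {δ} {a} {b} f e<1+n other at with m≤n⇒m<n∨m≡n (≤-pred e<1+n)
... | inj₂ refl
  rewrite at | ∑<-cong n {λ i → b i * f i} {λ i → a i * f i} (λ i i<n → cong (_* f i) (other i (<⇒≢ i<n)))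
  = regroup (∑< n (λ i → a i * f i)) (a e) δ (f e)
  where
  regroup : ∀ s a d x → s + (a + d) * x ≡ s + a * x + d * x
  regroup = solve-∀
... | inj₁ e<n
  rewrite ∑<-perturb n {e} {δ} {a} {b} f e<n other at | other n (≢-sym (<⇒≢ e<n))
  = regroup (∑< n (λ i → a i * f i)) (δ * f e) (a n * f n)
  where
  regroup : ∀ s x y → s + x + y ≡ s + y + x
  regroup = solve-∀

-- The sum at `suc s` has the additional index `s`, where `f` vanishes, and the only weight that may
-- change is that of `π₁ s`, an index at most `s`.
functional-step : ∀ s {f} → f s ≡ 0 → functional (suc s) 0 f ≡ functional s 0 f + increase s * f (π₁ s)
functional-step s {f} fs≡0 = trans
  (∑<-perturb (suc s) f (s≤s (π₁≤ s)) (λ i → weight-other i s) (weight-increase s))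
  (cong (_+ increase s * f (π₁ s)) (trans (cong (λ x → functional s 0 f + weight s s * x) fs≡0)
    (trans (cong (functional s 0 f +_) (*-zeroʳ (weight s s))) (+-identityʳ _))))

n<[1+n]! : ∀ n → n < (1 + n) !
n<[1+n]! n = m≤m*n (suc n) (n !) {{n !≢0}}

-- With `F = (1 + s) !`, the weights are at most `F + 1` and the coefficients add up to at most `s`;
-- and `(F + 1) * s < (2 + s) * F` because `s < F`. This bound dictates the factorial in `value`.
functional-< : ∀ s {f} → Bounded s f → functional s 0 f < (2 + s) !
functional-< s {f} bf = begin-strict
  functional s 0 f                        ≤⟨ ∑<-mono s (λ i → *-monoˡ-≤ (f i) (weight-≤ i s)) ⟩
  ∑< s (λ i → suc F * f i)                ≡⟨ ∑<-* s (suc F) f ⟩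
  suc F * ∑< s f                          ≤⟨ *-monoʳ-≤ (suc F) (total bf s) ⟩
  suc F * s                               ≡⟨ regroup F s ⟩
  s + s * F                               <⟨ +-monoˡ-< (s * F) (<-≤-trans (n<[1+n]! s) (m≤m+n F F)) ⟩
  F + F + s * F                           ≡⟨ +-assoc F F (s * F) ⟩
  (2 + s) !                               ∎
  where
  open ≤-Reasoning
  F = (1 + s) !
  regroup : ∀ F s → suc F * s ≡ s + s * F
  regroup = solve-∀

quotient-unique : ∀ v {a b} p q → a < v → b < v → a + v * p ≡ b + v * q → p ≡ q
quotient-unique v p q a<v b<v eq = ≤-antisym (≮⇒≥ (not-< p q b<v eq)) (≮⇒≥ (not-< q p a<v (sym eq)))
  where
  not-< : ∀ {a b} p q → b < v → a + v * p ≡ b + v * q → ¬ q < p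
  not-< {a} {b} p q b<v eq q<p = <⇒≢ (begin-strict
    b + v * q     <⟨ +-monoˡ-< (v * q) b<v ⟩
    v + v * q     ≡⟨ sym (*-suc v q) ⟩
    v * suc q     ≤⟨ *-monoʳ-≤ v q<p ⟩
    v * p         ≤⟨ m≤n+m (v * p) a ⟩
    a + v * p     ∎) (sym eq)
    where open ≤-Reasoning

module _ {s : ℕ} {f g : ℕ → ℕ} (bf : Bounded s f) (bg : Bounded s g) where

  private
    e = π₁ s
    δ = increase s

    coordinate : δ * f e ≡ δ * g e → ∀ i t → functional t (suc i) f ≡ functional t (suc i) g →
                 ∀ t′ → weight i t′ ≡ weight i t ⊎ (i ≡ e × NonZero δ) →
                 functional t′ (suc i) f ≡ functional t′ (suc i) g
    coordinate eq i t h t′ (inj₁ w≡)          = subst (λ w → (1 ∸ w) * f i ≡ (1 ∸ w) * g i) (sym w≡) h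
    coordinate eq i t h t′ (inj₂ (refl , δ≢0)) =
      cong ((1 ∸ weight e t′) *_) (*-cancelˡ-≡ (f e) (g e) δ {{δ≢0}} eq)

  -- A generator tied at this stage was free before, so its own coordinate already forces
  -- `f e ≡ g e`, and coordinate 0 changes by the same amount on both sides.
  agree-suc : Agree s f g → Agree (suc s) f g
  agree-suc h = λ where
      zero    → trans (functional-step s (support bf ≤-refl))
                  (trans (cong₂ _+_ (h 0) δf≡δg) (sym (functional-step s (support bg ≤-refl))))
      (suc i) → coordinate δf≡δg i s (h (suc i)) (suc s) (weight-changes i s)
    where
    δf≡δg : δ * f e ≡ δ * g e
    δf≡δg with increase-cases s
    ... | inj₁ δ≡0       = subst (λ d → d * f e ≡ d * g e) (sym δ≡0) refl
    ... | inj₂ (w≡0 , _) = cong (δ *_)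
      -- With 0 in place of the weight, `(1 ∸ 0) * f e` reduces to `f e + 0`.
      (+-cancelʳ-≡ 0 _ _ (subst (λ w → (1 ∸ w) * f e ≡ (1 ∸ w) * g e) w≡0 (h (suc e))))

  -- No new coincidence arises: in `a + δ * f e ≡ a′ + δ * g e` both `a` and `a′` are below a
  -- nonzero `δ`, so division with remainder gives `f e ≡ g e`, and then `a ≡ a′`. This is what the
  -- fast growth of the weights is for.
  agree-pred : Agree (suc s) f g → Agree s f g
  agree-pred h = λ where
      zero    → +-cancelʳ-≡ (δ * g e) _ _ (trans (cong (functional s 0 f +_) (sym δf≡δg)) sums)
      (suc i) → coordinate δf≡δg i (suc s) (h (suc i)) s (map₁ sym (weight-changes i s))
    where
    sums : functional s 0 f + δ * f e ≡ functional s 0 g + δ * g e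
    sums = trans (sym (functional-step s (support bf ≤-refl)))
      (trans (h 0) (functional-step s (support bg ≤-refl)))
    δf≡δg : δ * f e ≡ δ * g e
    δf≡δg with increase-cases s
    ... | inj₁ δ≡0       = subst (λ d → d * f e ≡ d * g e) (sym δ≡0) refl
    ... | inj₂ (_ , δ≥) = cong (δ *_) (quotient-unique δ (f e) (g e)
      (<-≤-trans (functional-< s bf) δ≥) (<-≤-trans (functional-< s bg) δ≥) sums)

-- The group of germs

module _ {B : ℕ} {f g : ℕ → ℕ} (bf : Bounded B f) (bg : Bounded B g) where

  private
    weaken : ∀ {A h} d → Bounded A h → Bounded (d + A) h
    weaken {A} d bh = bounded
      (λ le → support bh (≤-trans (m≤n+m A d) le)) (λ n → ≤-trans (total bh n) (m≤n+m A d))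

  agree-up : ∀ d → Agree B f g → Agree (d + B) f g
  agree-up zero    h = h
  agree-up (suc d) h = agree-suc (weaken d bf) (weaken d bg) (agree-up d h)

  agree-down : ∀ d → Agree (d + B) f g → Agree B f g
  agree-down zero    h = h
  agree-down (suc d) h = agree-down d (agree-pred (weaken d bf) (weaken d bg) h)

-- Finitely many coordinates suffice for `Agree`: from index `s` on, coefficients bounded by `s`
-- vanish.
discrepancy : ℕ → (ℕ → ℕ) → (ℕ → ℕ) → ℕ
discrepancy s f g = ∑< s (λ i → (1 ∸ weight i s) * dist (f i) (g i)) + dist (functional s 0 f) (functional s 0 g)

*-dist : ∀ m {a b} → m * dist a b ≡ 0 → m * a ≡ m * b
*-dist zero    _ = refl
*-dist (suc m) {a} {b} p = cong (suc m *_) (dist≡0⇒≡ a b (m+n≡0⇒m≡0 (dist a b) p))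

dist-* : ∀ m {a b} → m * a ≡ m * b → m * dist a b ≡ 0
dist-* zero    _ = refl
dist-* (suc m) {a} {b} p rewrite *-cancelˡ-≡ a b (suc m) p | dist-self b = *-zeroʳ (suc m)

discrepancy⇒agree : ∀ {s f g} → Bounded s f → Bounded s g → discrepancy s f g ≡ 0 → Agree s f g
discrepancy⇒agree {s} bf bg h zero    = dist≡0⇒≡ _ _ (m+n≡0⇒n≡0 (∑< s _) h)
discrepancy⇒agree {s} bf bg h (suc i) with i <? s
... | yes i<s = *-dist (1 ∸ weight i s) (∑<-≡0 s (m+n≡0⇒m≡0 _ h) i i<s)
... | no  i≮s = cong ((1 ∸ weight i s) *_) (trans (support bf (≮⇒≥ i≮s)) (sym (support bg (≮⇒≥ i≮s))))

agree⇒discrepancy : ∀ {s f g} → Agree s f g → discrepancy s f g ≡ 0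
agree⇒discrepancy {s} {f} {g} h = cong₂ _+_
  (∑<-0 s λ i _ → dist-* (1 ∸ weight i s) (h (suc i)))
  (trans (cong (dist (functional s 0 f)) (sym (h 0))) (dist-self (functional s 0 f)))

⊖-+ : ∀ a b c d → (a ⊖ b) ℤ.+ (c ⊖ d) ≡ (a + c) ⊖ (b + d)
⊖-+ a b c d = begin
  (a ⊖ b) ℤ.+ (c ⊖ d)                                        ≡⟨ sym (cong₂ ℤ._+_ (ℤ.m-n≡m⊖n a b) (ℤ.m-n≡m⊖n c d)) ⟩
  (ℤ.+ a ℤ.- ℤ.+ b) ℤ.+ (ℤ.+ c ℤ.- ℤ.+ d)                    ≡⟨ regroup (ℤ.+ a) (ℤ.+ b) (ℤ.+ c) (ℤ.+ d) ⟩
  (ℤ.+ a ℤ.+ ℤ.+ c) ℤ.- (ℤ.+ b ℤ.+ ℤ.+ d)                    ≡⟨ ℤ.m-n≡m⊖n (a + c) (b + d) ⟩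
  (a + c) ⊖ (b + d)                                          ∎
  where
  open ≡-Reasoning
  regroup : ∀ x y z w → (x ℤ.- y) ℤ.+ (z ℤ.- w) ≡ (x ℤ.+ z) ℤ.- (y ℤ.+ w)
  regroup = solve-∀ℤ

⊖-≡⇒ : ∀ {a b c d : ℕ} → a ⊖ b ≡ c ⊖ d → a + d ≡ b + c
⊖-≡⇒ {a} {b} {c} {d} eq = ℤ.+-injective (begin
  ℤ.+ a ℤ.+ ℤ.+ d                          ≡⟨ expand (ℤ.+ a) (ℤ.+ b) (ℤ.+ d) ⟩
  (ℤ.+ a ℤ.- ℤ.+ b) ℤ.+ (ℤ.+ b ℤ.+ ℤ.+ d)  ≡⟨ cong (λ z → z ℤ.+ (ℤ.+ b ℤ.+ ℤ.+ d)) differences ⟩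
  (ℤ.+ c ℤ.- ℤ.+ d) ℤ.+ (ℤ.+ b ℤ.+ ℤ.+ d)  ≡⟨ collapse (ℤ.+ b) (ℤ.+ c) (ℤ.+ d) ⟩
  ℤ.+ b ℤ.+ ℤ.+ c                          ∎)
  where
  open ≡-Reasoning
  differences : ℤ.+ a ℤ.- ℤ.+ b ≡ ℤ.+ c ℤ.- ℤ.+ d
  differences = trans (ℤ.m-n≡m⊖n a b) (trans eq (sym (ℤ.m-n≡m⊖n c d)))
  expand : ∀ x y w → x ℤ.+ w ≡ (x ℤ.- y) ℤ.+ (y ℤ.+ w)
  expand = solve-∀ℤ
  collapse : ∀ y z w → (z ℤ.- w) ℤ.+ (y ℤ.+ w) ≡ y ℤ.+ z
  collapse = solve-∀ℤ

⊖-≡⇐ : ∀ {a b c d : ℕ} → a + d ≡ b + c → a ⊖ b ≡ c ⊖ d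
⊖-≡⇐ {a} {b} {c} {d} eq = begin
  a ⊖ b               ≡⟨ ℤ.+-cancelˡ-⊖ d a b ⟨
  (d + a) ⊖ (d + b)   ≡⟨ cong₂ _⊖_ (trans (+-comm d a) eq) (+-comm d b) ⟩
  (b + c) ⊖ (b + d)   ≡⟨ ℤ.+-cancelˡ-⊖ b c d ⟩
  c ⊖ d               ∎
  where open ≡-Reasoning

Eventually : (ℕ → Set) → Set
Eventually P = ∃ λ s₀ → ∀ s → s₀ ≤ s → P s

both : ∀ {P Q R : ℕ → Set} → (∀ s → P s → Q s → R s) → Eventually P → Eventually Q → Eventually R
both h (s , p) (t , q) = s ⊔ t , λ u le → h u (p u (≤-trans (m≤m⊔n s t) le)) (q u (≤-trans (m≤n⊔m s t) le))

always : ∀ {P : ℕ → Set} → (∀ s → P s) → Eventually P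
always p = 0 , λ s _ → p s

-- The arguments of an element are a stage and a coordinate. The operations are pointwise, so the
-- laws hold at every stage.
germs : AbelianGroup 0ℓ 0ℓ
germs = record
  { Carrier = ℕ → ℕ → ℤ
  ; _≈_ = λ g h → Eventually λ s → ∀ j → g s j ≡ h s j
  ; _∙_ = λ g h s j → g s j ℤ.+ h s j
  ; ε   = λ _ _ → ℤ.0ℤ
  ; _⁻¹ = λ g s j → ℤ.- g s j
  ; isAbelianGroup = record
    { isGroup = record
      { isMonoid = record
        { isSemigroup = record
          { isMagma = record
            { isEquivalence = record
              { refl  = always λ _ _ → refl
              ; sym   = λ p → proj₁ p , λ s le j → sym (proj₂ p s le j)
              ; trans = both λ _ p q j → trans (p j) (q j) }
            ; ∙-cong = both λ _ p q j → cong₂ ℤ._+_ (p j) (q j) }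
          ; assoc = λ g h k → always λ s j → ℤ.+-assoc (g s j) (h s j) (k s j) }
        ; identity = (λ g → always λ s j → ℤ.+-identityˡ (g s j)) , (λ g → always λ s j → ℤ.+-identityʳ (g s j)) }
      ; inverse = (λ g → always λ s j → ℤ.+-inverseˡ (g s j)) , (λ g → always λ s j → ℤ.+-inverseʳ (g s j))
      ; ⁻¹-cong = λ p → proj₁ p , λ s le j → cong ℤ.-_ (proj₂ p s le j) }
    ; comm = λ g h → always λ s j → ℤ.+-comm (g s j) (h s j) } }

open AbelianGroup germs using (_≈_; _∙_; ε)
  renaming (refl to ≈-refl; sym to ≈-sym; trans to ≈-trans; ∙-cong to ∙-cong≈)

pos neg : ℕ → ℕ → ℕ → ℕ
pos s j x = functional s j (coef (π₁ x))
neg s j x = functional s j (coef (π₂ x))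

-- Codes have natural coefficients only, so a number `x` stands for the difference of the
-- combinations coded by `π₁ x` and `π₂ x`.
germ : ℕ → ℕ → ℕ → ℤ
germ x s j = pos s j x ⊖ neg s j x

side : ℕ → ℕ → ℕ → ℕ → ℕ
side P Q R i = coef P i + coef Q i + coef R i

functional-side : ∀ s j P Q R → functional s j (side P Q R) ≡
                  functional s j (coef P) + functional s j (coef Q) + functional s j (coef R)
functional-side s j P Q R = trans (functional-+ s j (λ i → coef P i + coef Q i) (coef R))
  (cong (_+ functional s j (coef R)) (functional-+ s j (coef P) (coef Q)))

side-bounded : ∀ {x y z} P Q R → P ≤ x → Q ≤ y → R ≤ z → Bounded (x + y + z) (side P Q R)
side-bounded P Q R p q r = +-bounded (+-bounded (coef-bounded P p) (coef-bounded Q q)) (coef-bounded R r)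

module _ (x y z : ℕ) where

  -- The equation `x + y = z` between combinations, with the negative parts moved across so that
  -- both sides have natural coefficients.
  lhs rhs : ℕ → ℕ
  lhs = side (π₁ x) (π₁ y) (π₂ z)
  rhs = side (π₂ x) (π₂ y) (π₁ z)

  lhs-bounded : Bounded (x + y + z) lhs
  lhs-bounded = side-bounded _ _ _ (π₁≤ x) (π₁≤ y) (π₂≤ z)

  rhs-bounded : Bounded (x + y + z) rhs
  rhs-bounded = side-bounded _ _ _ (π₂≤ x) (π₂≤ y) (π₁≤ z)

  agree⇒germ : ∀ s → Agree s lhs rhs → ∀ j → germ x s j ℤ.+ germ y s j ≡ germ z s j
  agree⇒germ s h j = trans (⊖-+ (pos s j x) (neg s j x) (pos s j y) (neg s j y))
    (⊖-≡⇐ {d = neg s j z} (trans (sym (functional-side s j (π₁ x) (π₁ y) (π₂ z)))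
      (trans (h j) (functional-side s j (π₂ x) (π₂ y) (π₁ z)))))

  germ⇒agree : ∀ s → (∀ j → germ x s j ℤ.+ germ y s j ≡ germ z s j) → Agree s lhs rhs
  germ⇒agree s h j = trans (functional-side s j (π₁ x) (π₁ y) (π₂ z))
    (trans (⊖-≡⇒ {c = pos s j z} (trans (sym (⊖-+ (pos s j x) (neg s j x) (pos s j y) (neg s j y))) (h j)))
           (sym (functional-side s j (π₂ x) (π₂ y) (π₁ z))))

  opaque
    -- Both sides are bounded by `x + y + z`, and from this stage on `agree-up` and `agree-down`
    -- carry agreement forwards and backwards; so this one stage decides an equality of germs.
    sumTest : ℕ
    sumTest = discrepancy (x + y + z) lhs rhs

    sumTest-def : discrepancy (x + y + z) lhs rhs ≡ sumTest
    sumTest-def = refl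

    sumTest-sound : sumTest ≡ 0 → germ x ∙ germ y ≈ germ z
    sumTest-sound h = x + y + z , λ s le → agree⇒germ s (subst (λ t → Agree t lhs rhs) (m∸n+n≡m le)
      (agree-up lhs-bounded rhs-bounded (s ∸ (x + y + z)) (discrepancy⇒agree lhs-bounded rhs-bounded h)))

    sumTest-complete : germ x ∙ germ y ≈ germ z → sumTest ≡ 0
    sumTest-complete (s₀ , h) = agree⇒discrepancy (agree-down lhs-bounded rhs-bounded s₀
      (germ⇒agree (s₀ + (x + y + z)) (h (s₀ + (x + y + z)) (m≤m+n s₀ _))))

germ-0 : germ 0 ≈ ε
germ-0 = always λ s j → trans
  (cong₂ (λ P Q → functional s j (coef P) ⊖ functional s j (coef Q)) (n≤0⇒n≡0 (π₁≤ 0)) (n≤0⇒n≡0 (π₂≤ 0)))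
  (ℤ.n⊖n≡0 (functional s j (coef 0)))

add : ℕ → ℕ → ℕ
add P Q = encode (λ i → coef P i + coef Q i) (P + Q)

functional-add : ∀ s j P Q → functional s j (coef (add P Q)) ≡ functional s j (coef P) + functional s j (coef Q)
functional-add s j P Q = trans
  (functional-cong s j (coef-encode (P + Q) _
     (λ i → support (+-bounded (coef-bounded P ≤-refl) (coef-bounded Q ≤-refl)))))
  (functional-+ s j (coef P) (coef Q))

germ-pair : ∀ P Q s j → germ (pair P Q) s j ≡ functional s j (coef P) ⊖ functional s j (coef Q)
germ-pair P Q s j = cong₂ (λ P Q → functional s j (coef P) ⊖ functional s j (coef Q)) (π₁-pair P Q) (π₂-pair P Q)

germ-sum : ∀ x y → germ x ∙ germ y ≈ germ (pair (add (π₁ x) (π₁ y)) (add (π₂ x) (π₂ y)))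
germ-sum x y = always λ s j → trans (⊖-+ (pos s j x) (neg s j x) (pos s j y) (neg s j y))
  (trans (sym (cong₂ _⊖_ (functional-add s j (π₁ x) (π₁ y)) (functional-add s j (π₂ x) (π₂ y))))
         (sym (germ-pair (add (π₁ x) (π₁ y)) (add (π₂ x) (π₂ y)) s j)))

germ-inverse : ∀ x → germ x ∙ germ (pair (π₂ x) (π₁ x)) ≈ ε
germ-inverse x = always λ s j → trans (cong (ℤ._+_ (germ x s j)) (germ-pair (π₂ x) (π₁ x) s j))
  (trans (⊖-+ (pos s j x) (neg s j x) (neg s j x) (pos s j x))
  (trans (cong (_⊖_ (pos s j x + neg s j x)) (+-comm (neg s j x) (pos s j x)))
         (ℤ.n⊖n≡0 (pos s j x + neg s j x))))

-- Computability of the test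

factorialF : Fun ∅ 1
factorialF = define₁ _! (rec (var 0F) (lit 1) (succ (var 0F) ⊠ var 1F)) eq
  where
  eq : ∀ n → primrec 1 (λ k r → suc k * r) n ≡ n !
  eq zero    = refl
  eq (suc n) = cong (suc n *_) (eq n)

weightF : Fun ∅ 2
weightF = define₂ weight
  (rec (var 1F) (lit 1 ⊟ var 0F)
    (ifz (var 1F)
         (ifz (call₂ distF (call₁ π₁F (var 0F)) (var 2F))
              (ifz (call₂ outputF (var 2F) (call₁ π₂F (var 0F)))
                   (lit 0)
                   (call₁ factorialF (succ (succ (var 2F))) ⊞ (lit 1 ⊟ (lit 1 ⊟ var 0F))))
              (lit 0))
         (var 3F)))
  weight-def

sideF : Fun ∅ 4
sideF = define (λ { (P ∷ Q ∷ R ∷ i ∷ []) → side P Q R i })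
  (call₂ coefF (var 0F) (var 3F) ⊞ call₂ coefF (var 1F) (var 3F) ⊞ call₂ coefF (var 2F) (var 3F))
  λ { (P ∷ Q ∷ R ∷ i ∷ []) → refl }

sumTestF : Fun ∅ 3
sumTestF = define₃ sumTest
  (sumTo (size 0F 1F 2F)
     ((lit 1 ⊟ call₂ weightF (var 0F) (size 2F 3F 4F)) ⊠ call₂ distF (sideT π₁F π₂F) (sideT π₂F π₁F))
   ⊞ call₂ distF (weighted (sideT π₁F π₂F)) (weighted (sideT π₂F π₁F)))
  sumTest-def
  where
  size : ∀ {n} → Fin n → Fin n → Fin n → Tm ∅ n
  size x y z = var x ⊞ var y ⊞ var z
  sideT : Fun ∅ 1 → Fun ∅ 1 → Tm ∅ 5
  sideT F F′ = call sideF (call₁ F (var 2F) ∷ call₁ F (var 3F) ∷ call₁ F′ (var 4F) ∷ var 0F ∷ [])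
  weighted : Tm ∅ 5 → Tm ∅ 3
  weighted t = sumTo (size 0F 1F 2F) (call₂ weightF (var 0F) (size 2F 3F 4F) ⊠ t)

numbering : Numbering germs
numbering = record
  { φ             = germ
  ; testF         = sumTestF
  ; test-sound    = sumTest-sound
  ; test-complete = sumTest-complete
  ; φ-0           = germ-0
  ; sum-code      = λ x y → _ , germ-sum x y
  ; inverse-code  = λ x → _ , germ-inverse x
  }

-- Colourings separate the outputs

unit : ℕ → ℕ
unit = primrec (pair 1 0) (λ _ r → pair 0 r)

unitF : ∀ {X} → Fun X 1
unitF = define₁ unit (rec (var 0F) (call₂ pairF (lit 1) (lit 0)) (call₂ pairF (lit 0) (var 1F))) (λ _ → refl)

coef-0 : ∀ i → coef 0 i ≡ 0
coef-0 i = coef-support i 0 z≤n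

coef-unit : ∀ e → coef (unit e) e ≡ 1
coef-unit zero    = π₁-pair 1 0
coef-unit (suc e) = trans (coef-pair-suc 0 (unit e) e) (coef-unit e)

coef-unit-≢ : ∀ e i → i ≢ e → coef (unit e) i ≡ 0
coef-unit-≢ zero    zero    ≢ = contradiction refl ≢
coef-unit-≢ zero    (suc i) _ = trans (coef-pair-suc 1 0 i) (coef-0 i)
coef-unit-≢ (suc e) zero    _ = π₁-pair 0 (unit e)
coef-unit-≢ (suc e) (suc i) ≢ = trans (coef-pair-suc 0 (unit e) i) (coef-unit-≢ e i (≢ ∘ cong suc))

∑<-single : ∀ n {e} {f : ℕ → ℕ} → e < n → (∀ i → i ≢ e → f i ≡ 0) → ∑< n f ≡ f e
∑<-single (suc n) {e} {f} e<1+n h with m≤n⇒m<n∨m≡n (≤-pred e<1+n)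
... | inj₁ e<n  = trans (cong₂ _+_ (∑<-single n e<n h) (h n (≢-sym (<⇒≢ e<n)))) (+-identityʳ (f e))
... | inj₂ refl = cong (_+ f n) (∑<-0 n λ i i<n → h i (<⇒≢ i<n))

module _ {s e : ℕ} {f : ℕ → ℕ} (e<s : e < s) (concentrated : ∀ i → i ≢ e → f i ≡ 0) (w≢0 : weight e s ≢ 0) where

  functional-concentrated : functional s 0 f ≡ weight e s * f e
  functional-concentrated = ∑<-single s {f = λ i → weight i s * f i} e<s
    (λ i i≢e → trans (cong (weight i s *_) (concentrated i i≢e)) (*-zeroʳ (weight i s)))

  functional-suc-concentrated : ∀ k → functional s (suc k) f ≡ 0
  functional-suc-concentrated k with k ≟ e
  ... | yes refl = cong (_* f e) (1∸ (weight e s) w≢0)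
    where
    1∸ : ∀ w → w ≢ 0 → 1 ∸ w ≡ 0
    1∸ zero    ≢ = contradiction refl ≢
    1∸ (suc w) _ = 0∸n≡0 w
  ... | no k≢e = trans (cong ((1 ∸ weight k s) *_) (concentrated k k≢e)) (*-zeroʳ (1 ∸ weight k s))

generator multiple : ℕ → ℕ
generator i = pair (unit i) 0
multiple N  = pair (pair N 0) 0

multiple-concentrated : ∀ N i → i ≢ 0 → coef (pair N 0) i ≡ 0
multiple-concentrated N zero    ≢ = contradiction refl ≢
multiple-concentrated N (suc i) _ = trans (coef-pair-suc N 0 i) (coef-0 i)

weight-0≢0 : ∀ s → weight 0 s ≢ 0
weight-0≢0 s ≡0 = contradiction (trans (sym (weight-0 s)) ≡0) λ ()


generator≈multiple : ∀ i N → N ≢ 0 → Eventually (λ s → weight i s ≡ N) → germ (generator i) ≈ germ (multiple N)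
-- From stage `suc i` on, the sum over the indices below `s` includes `i`.
generator≈multiple i N N≢0 (s₀ , w≡) = s₀ ⊔ suc i , λ s le j → trans (germ-pair _ _ s j)
  (trans (cong (_⊖ functional s j (coef 0))
     (values s (≤-trans (m≤m⊔n s₀ (suc i)) le) (≤-trans (m≤n⊔m s₀ (suc i)) le) j))
  (sym (germ-pair _ _ s j)))
  where
  values : ∀ s → s₀ ≤ s → i < s → ∀ j → functional s j (coef (unit i)) ≡ functional s j (coef (pair N 0))
  values s s₀≤s i<s zero = begin
    functional s 0 (coef (unit i))     ≡⟨ functional-concentrated i<s (coef-unit-≢ i) w≢0 ⟩
    weight i s * coef (unit i) i       ≡⟨ cong₂ _*_ (w≡ s s₀≤s) (coef-unit i) ⟩
    N * 1                              ≡⟨ *-comm N 1 ⟩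
    1 * N                              ≡⟨ cong₂ _*_ (weight-0 s) (π₁-pair N 0) ⟨
    weight 0 s * coef (pair N 0) 0     ≡⟨ functional-concentrated 0<s (multiple-concentrated N) (weight-0≢0 s) ⟨
    functional s 0 (coef (pair N 0))   ∎
    where
    open ≡-Reasoning
    0<s = ≤-<-trans z≤n i<s
    w≢0 : weight i s ≢ 0
    w≢0 = N≢0 ∘ trans (sym (w≡ s s₀≤s))
  values s s₀≤s i<s (suc k) = trans
    (functional-suc-concentrated i<s (coef-unit-≢ i) (N≢0 ∘ trans (sym (w≡ s s₀≤s))) k)
    (sym (functional-suc-concentrated (≤-<-trans z≤n i<s) (multiple-concentrated N) (weight-0≢0 s) k))

functional-merge : ∀ s j P Q R → (∀ i → coef P i + coef Q i ≡ coef R i) →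
                   functional s j (coef P) + functional s j (coef Q) ≡ functional s j (coef R)
functional-merge s j P Q R h = trans (sym (functional-+ s j (coef P) (coef Q))) (functional-cong s j h)

germ-merge : ∀ P Q P′ Q′ P″ Q″ →
             (∀ i → coef P i + coef P′ i ≡ coef P″ i) → (∀ i → coef Q i + coef Q′ i ≡ coef Q″ i) →
             ∀ s j → germ (pair P Q) s j ℤ.+ germ (pair P′ Q′) s j ≡ germ (pair P″ Q″) s j
germ-merge P Q P′ Q′ P″ Q″ hP hQ s j = trans (cong₂ ℤ._+_ (germ-pair P Q s j) (germ-pair P′ Q′ s j))
  (trans (⊖-+ (functional s j (coef P)) (functional s j (coef Q))
              (functional s j (coef P′)) (functional s j (coef Q′)))
  (trans (cong₂ _⊖_ (functional-merge s j P P′ P″ hP) (functional-merge s j Q Q′ Q″ hQ))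
         (sym (germ-pair P″ Q″ s j))))

multiple-+ : ∀ M N → germ (multiple M) ∙ germ (multiple N) ≈ germ (multiple (M + N))
multiple-+ M N = always (germ-merge (pair M 0) 0 (pair N 0) 0 (pair (M + N) 0) 0 sums zeros)
  where
  sums : ∀ i → coef (pair M 0) i + coef (pair N 0) i ≡ coef (pair (M + N) 0) i
  sums zero    = trans (cong₂ _+_ (π₁-pair M 0) (π₁-pair N 0)) (sym (π₁-pair (M + N) 0))
  sums (suc i) = trans (cong₂ _+_ (multiple-concentrated M (suc i) λ ()) (multiple-concentrated N (suc i) λ ()))
                       (sym (multiple-concentrated (M + N) (suc i) λ ()))
  zeros : ∀ i → coef 0 i + coef 0 i ≡ coef 0 i
  zeros i = cong (_+ coef 0 i) (coef-0 i)

multiple-0 : germ (multiple 0) ≈ ε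
multiple-0 = always λ s j → trans (germ-pair (pair 0 0) 0 s j)
  (trans (cong (_⊖ functional s j (coef 0)) (functional-cong s j zeros)) (ℤ.n⊖n≡0 (functional s j (coef 0))))
  where
  zeros : ∀ i → coef (pair 0 0) i ≡ coef 0 i
  zeros zero    = trans (π₁-pair 0 0) (sym (coef-0 0))
  zeros (suc i) = trans (multiple-concentrated 0 (suc i) λ ()) (sym (coef-0 (suc i)))

weight-origin : ∀ i s → i ≢ 0 → weight i s ≢ 0 →
                ∃ λ t → ∃ λ y → π₁ t ≡ i × output i (π₂ t) ≡ suc y × weight i s ≡ value t y
weight-origin zero    zero i≢0 _   = contradiction refl i≢0
weight-origin (suc i) zero _   w≢0 = contradiction (trans (weight-start (suc i)) (0∸n≡0 i)) w≢0
weight-origin i (suc s) i≢0 w≢0 with change i s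
... | same eq with weight-origin i s i≢0 (w≢0 ∘ trans eq)
...   | t , y , π₁≡ , o≡ , w≡ = t , y , π₁≡ , o≡ , trans eq w≡
weight-origin i (suc s) i≢0 w≢0 | fresh {y} π₁≡ _ o≡ w≡ = s , y , π₁≡ , o≡ , w≡

-- At stage `pair i t` the output is seen, unless the weight has been set before. In either case it
-- was set at a stage `s` with `π₁ s ≡ i`, hence `i ≤ s`, and for the same output by
-- `output-unique`.
weight-halted : ∀ i t {y} → i ≢ 0 → output i t ≡ suc y →
                ∃ λ s → i ≤ s × Eventually (λ r → weight i r ≡ value s y)
weight-halted i t {y} i≢0 o≡ = origin (weight-origin i (suc s₁) i≢0 nonzero)
  where
  s₁ = pair i t
  value≢0 : ∀ s y → value s y ≢ 0
  value≢0 s y ≡0 = <⇒≢ (1≤n! (2 + s)) (sym (m+n≡0⇒m≡0 ((2 + s) !) ≡0))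
  nonzero : weight i (suc s₁) ≢ 0
  nonzero with weight i s₁ ≟ 0
  ... | no  ≢0 = ≢0 ∘ trans (sym (weight-stable i s₁ ≢0))
  ... | yes ≡0 = value≢0 s₁ y ∘
      trans (sym (weight-fresh (π₁-pair i t) ≡0 (trans (cong (output i) (π₂-pair i t)) o≡)))
  origin : (∃ λ s → ∃ λ y′ → π₁ s ≡ i × output i (π₂ s) ≡ suc y′ × weight i (suc s₁) ≡ value s y′) →
           ∃ λ s → i ≤ s × Eventually (λ r → weight i r ≡ value s y)
  origin (s , y′ , refl , o≡′ , w≡) rewrite output-unique (π₁ s) t (π₂ s) o≡ o≡′ =
    s , π₁≤ s , suc s₁ , λ r le → trans
      (subst (λ r → weight (π₁ s) r ≡ weight (π₁ s) (suc s₁)) (m∸n+n≡m le)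
        (weight-persists (π₁ s) (suc s₁) (r ∸ suc s₁) nonzero)) w≡

-- The component `M` makes the index, and with it the stage of the relation, at least `M`, so that a
-- positive `M` divides the factorial in the weight.
index : ℕ → Code 1 → ℕ → ℕ
index M q x = pair M (pair ⌜ q ⌝ᶜ x)

≤index : ∀ M q x → M ≤ index M q x
≤index M q x = subst (_≤ index M q x) (π₁-pair M _) (π₁≤ (index M q x))

sign-bit : ∀ β → 1 ∸ (1 ∸ bit β) ≡ bit β
sign-bit true  = refl
sign-bit false = refl

module _ {G : ComputableAbelianGroup} (R : Realises germs germ G) where

  open Realises R
  open ComputableAbelianGroup G using (Carrier; _⊕_; 0#; ⊖_; _-_; sum; _·ℕ_; _·_; abelianGroup)

  b : Carrier
  b = element (multiple 1)

  ·ℕ-b : ∀ N → ⟪ N ·ℕ b ⟫ ≈ germ (multiple N)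
  ·ℕ-b zero    = ≈-trans ⟪0⟫ (≈-sym multiple-0)
  ·ℕ-b (suc N) = ≈-trans (⟪⊕⟫ b (N ·ℕ b)) (≈-trans (∙-cong≈ (⟪element⟫ (multiple 1)) (·ℕ-b N)) (multiple-+ 1 N))

  b≢0 : b ≢ 0#
  b≢0 b≡0 with ≈-trans (≈-sym (⟪element⟫ (multiple 1))) (≈-trans (subst (λ x → ⟪ b ⟫ ≈ ⟪ x ⟫) b≡0 ≈-refl) ⟪0⟫)
  ... | s₀ , h = contradiction (trans (sym value-1) (h (suc s₀) (n≤1+n s₀) 0)) λ ()
    where
    -- A positive stage, because at stage 0 the sum in coordinate 0 is empty.
    s = suc s₀
    at-0 : ∀ P → (∀ i → i ≢ 0 → coef P i ≡ 0) → functional s 0 (coef P) ≡ coef P 0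
    at-0 P conc = trans (functional-concentrated z<s conc (weight-0≢0 s))
      (trans (cong (_* coef P 0) (weight-0 s)) (*-identityˡ (coef P 0)))
    value-1 : germ (multiple 1) s 0 ≡ ℤ.+ 1
    value-1 = trans (germ-pair (pair 1 0) 0 s 0)
      (cong₂ _⊖_ (trans (at-0 (pair 1 0) (multiple-concentrated 1)) (π₁-pair 1 0))
                 (trans (at-0 0 (λ i _ → coef-0 i)) (coef-0 0)))

  generator-halted : ∀ m {q x β} → ∅ ⊢ q [ x ∷ [] ]⇓ bit β →
                     ∃ λ k → element (generator (index (suc m) q x)) ≡ (bit β + k * suc m) ·ℕ b
  generator-halted m {q} {x} {β} d with output-exists (suc m) d
  ... | t , o≡ with weight-halted (index (suc m) q x) t
                  (λ ≡0 → contradiction (subst (suc m ≤_) ≡0 (≤index (suc m) q x)) λ ()) o≡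
  ...   | s , i≤s , ev with ∣-trans (m∣m*n {suc m} (m !)) (m≤n⇒m!∣n! {suc m} {2 + s}
                              (≤-trans (≤index (suc m) q x) (≤-trans i≤s (m≤n+m s 2))))
  ...     | divides k eq = k , ⟪⟫-injective (≈-trans (⟪element⟫ _)
            (≈-trans (generator≈multiple _ N N≢0 (proj₁ ev , λ r le → trans (proj₂ ev r le) value≡))
            (≈-sym (·ℕ-b N))))
    where
    N = bit β + k * suc m
    value≡ : value s (bit β) ≡ N
    value≡ = trans (cong₂ _+_ eq (sign-bit β)) (+-comm (k * suc m) (bit β))
    N≢0 : N ≢ 0
    N≢0 N≡0 = <⇒≢ (1≤n! (2 + s)) (sym (trans eq (m+n≡0⇒n≡0 (bit β) N≡0)))

-- The usual characterisation of PA degrees by total extensions of partial 0-1-valued functions.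
-- Where `q` gives no bit, `F` may take any value.
Extends : (ℕ → ℕ) → Set
Extends X = ∀ q → ∃ λ (F : Fun X 1) → ∀ x β → ∅ ⊢ q [ x ∷ [] ]⇓ bit β → fn F (x ∷ []) ≡ bit β

toOracle-elem : ∀ (G : ComputableAbelianGroup) {k} (c : Coloring G k) x → toOracle G c (proj₁ x) ≡ toℕ (c x)
toOracle-elem G c (x , x∈G) with T? (ComputableAbelianGroup.dom G x)
... | yes x∈G′ = cong (λ p → toℕ (c (x , p))) (T-irrelevant x∈G′ x∈G)
... | no  x∉G  = contradiction x∈G x∉G

module _ {G : ComputableAbelianGroup} (R : Realises germs germ G) where

  open Realises R
  open ComputableAbelianGroup G using (Carrier; _⊕_; 0#; ⊖_; _-_; sum; _·ℕ_; _·_; abelianGroup)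
  open AbelianGroup abelianGroup using (identityˡ; identityʳ; inverseʳ; assoc)
  open GroupProperties (AbelianGroup.group abelianGroup) using (ε⁻¹≈ε)

  x-0≡x : ∀ x → x - 0# ≡ x
  x-0≡x x = trans (cong (x ⊕_) ε⁻¹≈ε) (identityʳ x)

  sum-zeros : ∀ n → sum {n} (λ _ → 0# - 0#) ≡ 0#
  sum-zeros zero    = refl
  sum-zeros (suc n) = trans (cong₂ _⊕_ (x-0≡x 0#) (sum-zeros n)) (identityˡ 0#)

  -- From c (b ⊕ w) ≡ c 0 and c 0 ≡ c w one gets the solution ((b ⊕ w) − 0) + (0 − w) + 0 + … = b.
  colours-differ : ∀ {n k a w} (c : Coloring G k) → 2 ≤ n → NoPairwiseMonochromaticSolution G n a c →
                   c 0# ≡ c w → c (a ⊕ w) ≢ c 0#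
  colours-differ {suc zero} c (s≤s ())
  colours-differ {suc (suc n)} {k} {a} {w} c _ none c0≡cw ca+w≡c0 = none (x , y , solution , monochromatic)
    where
    x y : Fin (2 + n) → Carrier
    x zero          = a ⊕ w
    x (suc _)       = 0#
    y zero          = 0#
    y (suc zero)    = w
    y (suc (suc _)) = 0#
    monochromatic : PairwiseMonochromatic G c x y
    monochromatic zero          = ca+w≡c0
    monochromatic (suc zero)    = c0≡cw
    monochromatic (suc (suc _)) = refl
    solution : sum (λ i → x i - y i) ≡ a
    solution = begin
      ((a ⊕ w) - 0#) ⊕ ((0# - w) ⊕ sum {n} (λ _ → 0# - 0#))
        ≡⟨ cong₂ (λ u v → u ⊕ ((0# - w) ⊕ v)) (x-0≡x (a ⊕ w)) (sum-zeros n) ⟩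
      (a ⊕ w) ⊕ ((0# - w) ⊕ 0#)
        ≡⟨ cong ((a ⊕ w) ⊕_) (trans (identityʳ (0# - w)) (identityˡ (⊖ w))) ⟩
      (a ⊕ w) ⊕ (⊖ w)       ≡⟨ assoc a w (⊖ w) ⟩
      a ⊕ (w - w)           ≡⟨ cong (a ⊕_) (inverseʳ w) ⟩
      a ⊕ 0#                ≡⟨ identityʳ a ⟩
      a                     ∎
      where open ≡-Reasoning

  module _ {n k : ℕ} (2≤n : 2 ≤ n) (c : Coloring G k) (none : NoPairwiseMonochromaticSolution G n (b R) c)
           (m : ℕ) (mono : (i j : ℤ) → c ((i *ᶻ ℤ.+ suc m) · b R) ≡ c ((j *ᶻ ℤ.+ suc m) · b R)) where

    private
      X : ℕ → ℕ
      X = toOracle G c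

    multiple-colour : ∀ l → c ((l * suc m) ·ℕ b R) ≡ c 0#
    multiple-colour l = trans (cong (λ z → c (z · b R)) (ℤ.pos-* l (suc m))) (mono (ℤ.+ l) 0ℤ)

    oracleF : Fun X 1
    oracleF = record { fn = uncurry₁ X ; code = oracle ; correct = λ { (x ∷ []) → ⇓-oracle } }

    differs : Carrier → ℕ
    differs u = 1 ∸ (1 ∸ dist (toℕ (c u)) (toℕ (c 0#)))

    differs-0 : ∀ u → c u ≡ c 0# → differs u ≡ 0
    differs-0 u eq rewrite eq | dist-self (toℕ (c 0#)) = refl

    differs-1 : ∀ u → c u ≢ c 0# → differs u ≡ 1
    differs-1 u ≢ with dist (toℕ (c u)) (toℕ (c 0#)) in d≡
    ... | zero  = contradiction (toℕ-injective (dist≡0⇒≡ _ _ d≡)) ≢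
    ... | suc v = cong (1 ∸_) (0∸n≡0 v)

    differs-combination : ∀ β l → differs ((bit β + l * suc m) ·ℕ b R) ≡ bit β
    differs-combination false l = differs-0 _ (multiple-colour l)
    -- The element unfolds to `b ⊕ w`, where `w` is a multiple of `suc m` times b and so has the
    -- colour of zero.
    differs-combination true  l = differs-1 _ (colours-differ c 2≤n none (sym (multiple-colour l)))

    programElement : Code 1 → ℕ → Carrier
    programElement q x = element (generator (index (suc m) q x))

    programElementF : Code 1 → Fun X 1
    programElementF q = define₁ (proj₁ ∘ programElement q)
      (call₁ (relativise elementF)
        (call₂ pairF (call₁ unitF (call₂ pairF (lit (suc m)) (call₂ pairF (lit ⌜ q ⌝ᶜ) (var 0F)))) (lit 0)))
      (λ x → fn-elementF (generator (index (suc m) q x)))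

    differsF : Code 1 → Fun X 1
    differsF q = define₁ (differs ∘ programElement q)
      (lit 1 ⊟ (lit 1 ⊟ call₂ distF (call₁ oracleF (call₁ (programElementF q) (var 0F))) (lit (toℕ (c 0#)))))
      (λ x → cong (λ v → 1 ∸ (1 ∸ dist v (toℕ (c 0#)))) (toOracle-elem G c (programElement q x)))

    extends : Extends X
    extends q = differsF q , λ x β d → let l , eq = generator-halted R m {q} {x} {β} d in
      trans (cong differs eq) (differs-combination β l)

-- Paths through trees

-- Successor in bijective base 2, least significant digit first: `false` and `true` are the digits 1
-- and 2.
increment : List Bool → List Bool
increment []          = false ∷ []
increment (false ∷ σ) = true ∷ σ
increment (true  ∷ σ) = false ∷ increment σ

decode : ℕ → List Bool
decode zero    = []
decode (suc n) = increment (decode n)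

⌜increment⌝ : ∀ σ → ⌜ increment σ ⌝ ≡ suc ⌜ σ ⌝
⌜increment⌝ []          = refl
⌜increment⌝ (false ∷ σ) = refl
⌜increment⌝ (true  ∷ σ) = trans (cong (λ n → 1 + 2 * n) (⌜increment⌝ σ)) (double ⌜ σ ⌝)
  where
  double : ∀ n → 1 + 2 * suc n ≡ 3 + 2 * n
  double = solve-∀

⌜decode⌝ : ∀ n → ⌜ decode n ⌝ ≡ n
⌜decode⌝ zero    = refl
⌜decode⌝ (suc n) = trans (⌜increment⌝ (decode n)) (cong suc (⌜decode⌝ n))

decode-odd : ∀ n → decode (1 + 2 * n) ≡ false ∷ decode n
decode-odd zero    = refl
decode-odd (suc n) rewrite +-suc n (n + 0) | decode-odd n = refl

decode-⌜⌝ : ∀ σ → decode ⌜ σ ⌝ ≡ σ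
decode-⌜⌝ []          = refl
decode-⌜⌝ (false ∷ σ) = trans (decode-odd ⌜ σ ⌝) (cong (false ∷_) (decode-⌜⌝ σ))
decode-⌜⌝ (true  ∷ σ) = trans (cong increment (decode-odd ⌜ σ ⌝)) (cong (true ∷_) (decode-⌜⌝ σ))

-- Hence the extensions of `σ` are found arithmetically from its code and `2 ^ length σ`; this pair
-- is the `position` used below.
⌜++⌝ : ∀ σ τ → ⌜ σ ++ τ ⌝ ≡ ⌜ σ ⌝ + 2 ^ length σ * ⌜ τ ⌝
⌜++⌝ []      τ = sym (*-identityˡ ⌜ τ ⌝)
⌜++⌝ (β ∷ σ) τ rewrite ⌜++⌝ σ τ = regroup (bit β) ⌜ σ ⌝ (2 ^ length σ) ⌜ τ ⌝
  where
  regroup : ∀ b s p t → 1 + b + 2 * (s + p * t) ≡ 1 + b + 2 * s + 2 * p * t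
  regroup = solve-∀

bit≤1 : ∀ β → bit β ≤ 1
bit≤1 true  = s≤s z≤n
bit≤1 false = z≤n

⌜⌝-lower : ∀ σ → 2 ^ length σ ≤ suc ⌜ σ ⌝
⌜⌝-lower []      = s≤s z≤n
⌜⌝-lower (β ∷ σ) = begin
  2 * 2 ^ length σ          ≤⟨ *-monoʳ-≤ 2 (⌜⌝-lower σ) ⟩
  2 * suc ⌜ σ ⌝             ≤⟨ m≤m+n _ (bit β) ⟩
  2 * suc ⌜ σ ⌝ + bit β     ≡⟨ regroup (bit β) ⌜ σ ⌝ ⟩
  suc (1 + bit β + 2 * ⌜ σ ⌝) ∎
  where
  open ≤-Reasoning
  regroup : ∀ b s → 2 * suc s + b ≡ suc (1 + b + 2 * s)
  regroup = solve-∀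

⌜⌝-upper : ∀ σ → suc ⌜ σ ⌝ < 2 ^ suc (length σ)
⌜⌝-upper []      = s≤s (s≤s z≤n)
⌜⌝-upper (β ∷ σ) = begin-strict
  suc (1 + bit β + 2 * ⌜ σ ⌝)   ≤⟨ s≤s (+-monoˡ-≤ (2 * ⌜ σ ⌝) (s≤s (bit≤1 β))) ⟩
  3 + 2 * ⌜ σ ⌝                 <⟨ n<1+n _ ⟩
  4 + 2 * ⌜ σ ⌝                 ≡⟨ regroup ⌜ σ ⌝ ⟩
  2 * (2 + ⌜ σ ⌝)               ≤⟨ *-monoʳ-≤ 2 (⌜⌝-upper σ) ⟩
  2 * 2 ^ suc (length σ)        ∎
  where
  open ≤-Reasoning
  regroup : ∀ s → 4 + 2 * s ≡ 2 * (2 + s)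
  regroup = solve-∀

powF : ∀ {X} → Fun X 1
powF = define₁ (2 ^_) (rec (var 0F) (lit 1) (lit 2 ⊠ var 1F)) eq
  where
  eq : ∀ n → primrec 1 (λ _ r → 2 * r) n ≡ 2 ^ n
  eq zero    = refl
  eq (suc n) = cong (2 *_) (eq n)

nonzero : ℕ → Bool
nonzero zero    = false
nonzero (suc _) = true

bit-nonzero : ∀ n → 1 ∸ (1 ∸ n) ≡ bit (nonzero n)
bit-nonzero zero    = refl
bit-nonzero (suc n) = cong (1 ∸_) (0∸n≡0 n)

nonzero-bit : ∀ β → nonzero (bit β) ≡ β
nonzero-bit true  = refl
nonzero-bit false = refl

bit-false : ∀ {β} → ¬ T β → bit β ≡ 0
bit-false {true}  h = contradiction _ h
bit-false {false} _ = refl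

bit-true : ∀ {β} → T β → bit β ≢ 0
bit-true {true} _ ()

-- Following live strings

module _ {X : ℕ → ℕ} (extends : Extends X) (S : StringSet) (tree : IsTree S) (computable : IsComputable S)
         (infinite : IsInfinite S) where

  Dead : List Bool → ℕ → Set
  Dead σ h = ∀ τ → h ≤ length τ → ¬ T (S (σ ++ τ))

  Dead-children : ∀ σ {h h′} → Dead (σ ++ [ false ]) h → Dead (σ ++ [ true ]) h′ → Dead σ (suc (h ⊔ h′))
  Dead-children σ {h} {h′} d₀ d₁ (β ∷ τ) (s≤s le) Sσβτ =
    case-β β (subst (T ∘ S) (sym (++-assoc σ [ β ] τ)) Sσβτ)
    where
    case-β : ∀ β → ¬ T (S ((σ ++ [ β ]) ++ τ))
    case-β false = d₀ τ (≤-trans (m≤m⊔n h h′) le)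
    case-β true  = d₁ τ (≤-trans (m≤n⊔m h h′) le)

  -- A negative statement, which no algorithm need decide; live children are therefore obtained by
  -- refuting their death.
  Live : List Bool → Set
  Live σ = ∀ h → ¬ Dead σ h

  Live⇒∈ : ∀ {σ} → Live σ → T (S σ)
  Live⇒∈ {σ} live = decidable-stable (T? (S σ)) λ σ∉S → live 0 λ τ _ στ∈S → σ∉S (tree σ τ στ∈S)

  -- If the root were dead at height `h`, every member of `S` would be shorter than `h`, hence among
  -- the strings with codes below `2 ^ h`.
  Live-[] : Live []
  Live-[] h dead = infinite (List.map decode (upTo (2 ^ h)) , covered)
    where
    covered : ∀ σ → T (S σ) → σ ∈ List.map decode (upTo (2 ^ h))
    covered σ σ∈S = subst (_∈ _) (decode-⌜⌝ σ) (∈-map⁺ decode (∈-upTo⁺ (<-trans (n<1+n _)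
      (<-≤-trans (⌜⌝-upper σ) (^-monoʳ-≤ 2 (≰⇒> λ h≤ → dead σ h≤ σ∈S))))))

  member : ℕ → ℕ
  member v = bit (S (decode v))

  memberF : Fun ∅ 1
  memberF = record
    { fn      = uncurry₁ member
    ; code    = proj₁ computable
    ; correct = λ { (v ∷ []) → subst (λ u → ∅ ⊢ proj₁ computable [ u ∷ [] ]⇓ member v) (⌜decode⌝ v)
                                      (proj₂ computable (decode v)) }
    }

  -- The strings of length h have the codes 2 ^ h − 1 + v with v < 2 ^ h.
  survivors : ℕ → ℕ → ℕ → ℕ
  survivors c p h = ∑< (2 ^ h) (λ v → member (c + p * ((2 ^ h ∸ 1) + v)))

  survivorsF : Fun ∅ 3
  survivorsF = define₃ survivors
    (sumTo (call₁ powF (var 2F))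
      (call₁ memberF (var 2F ⊞ var 3F ⊠ ((call₁ powF (var 4F) ⊟ lit 1) ⊞ var 0F))))
    (λ _ _ _ → refl)

  -- An extension in `S` of length at least `h` could be cut to length exactly `h` without leaving
  -- the tree, and would then be counted.
  survivors≡0⇒Dead : ∀ σ h → survivors ⌜ σ ⌝ (2 ^ length σ) h ≡ 0 → Dead σ h
  survivors≡0⇒Dead σ h eq τ h≤ στ∈S = bit-true prefix∈S (trans (sym member≡) (∑<-≡0 (2 ^ h) eq v v<))
    where
    τ′ = take h τ
    length-τ′ : length τ′ ≡ h
    length-τ′ = trans (length-take h τ) (m≤n⇒m⊓n≡m h≤)
    prefix∈S : T (S (σ ++ τ′))
    prefix∈S = tree (σ ++ τ′) (drop h τ) (subst (T ∘ S)
      (sym (trans (++-assoc σ τ′ (drop h τ)) (cong (σ ++_) (take++drop≡id h τ)))) στ∈S)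
    v = suc ⌜ τ′ ⌝ ∸ 2 ^ h
    lower : 2 ^ h ≤ suc ⌜ τ′ ⌝
    lower = subst (λ n → 2 ^ n ≤ suc ⌜ τ′ ⌝) length-τ′ (⌜⌝-lower τ′)
    v< : v < 2 ^ h
    v< = +-cancelʳ-< (2 ^ h) v (2 ^ h) (subst₂ _<_ (sym (m∸n+n≡m lower)) (cong (2 ^ h +_) (+-identityʳ (2 ^ h)))
      (subst (λ n → suc ⌜ τ′ ⌝ < 2 ^ suc n) length-τ′ (⌜⌝-upper τ′)))
    code≡ : (2 ^ h ∸ 1) + v ≡ ⌜ τ′ ⌝
    code≡ = suc-injective (trans (cong (_+ v) (m+[n∸m]≡n (m^n>0 2 h))) (m+[n∸m]≡n lower))
    member≡ : member (⌜ σ ⌝ + 2 ^ length σ * ((2 ^ h ∸ 1) + v)) ≡ bit (S (σ ++ τ′))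
    member≡ = cong (bit ∘ S) (trans
      (cong decode (trans (cong (λ n → ⌜ σ ⌝ + 2 ^ length σ * n) code≡) (sym (⌜++⌝ σ τ′))))
      (decode-⌜⌝ (σ ++ τ′)))

  Dead⇒survivors≡0 : ∀ σ h → Dead σ h → survivors ⌜ σ ⌝ (2 ^ length σ) h ≡ 0
  Dead⇒survivors≡0 σ h dead = ∑<-0 (2 ^ h) vanish
    where
    vanish : ∀ v → v < 2 ^ h → member (⌜ σ ⌝ + 2 ^ length σ * ((2 ^ h ∸ 1) + v)) ≡ 0
    vanish v _ = trans (cong (bit ∘ S) (trans
        (cong decode (trans (cong (λ n → ⌜ σ ⌝ + 2 ^ length σ * n) (sym (⌜decode⌝ n))) (sym (⌜++⌝ σ τ))))
        (decode-⌜⌝ (σ ++ τ))))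
      (bit-false (dead τ (≮⇒≥ λ short → <⇒≱ (⌜⌝-upper τ) (≤-trans (^-monoʳ-≤ 2 short) long))))
      where
      n = (2 ^ h ∸ 1) + v
      τ = decode n
      long : 2 ^ h ≤ suc ⌜ τ ⌝
      long = subst (λ m → 2 ^ h ≤ suc m) (sym (⌜decode⌝ n))
        (subst (_≤ suc n) (m+[n∸m]≡n (m^n>0 2 h)) (s≤s (m≤m+n (2 ^ h ∸ 1) v)))

  -- Acts on pairs of a code and a power of 2: appending the bit `β` adds the power times `suc β`,
  -- the code of a one-letter string.
  child : ℕ → ℕ → ℕ
  child β x = pair (π₁ x + π₂ x * suc β) (2 * π₂ x)

  position : List Bool → ℕ
  position σ = pair ⌜ σ ⌝ (2 ^ length σ)

  position-child : ∀ σ β → child (bit β) (position σ) ≡ position (σ ++ [ β ])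
  position-child σ β = cong₂ pair
    (trans (cong₂ (λ c p → c + p * suc (bit β)) (π₁-pair ⌜ σ ⌝ _) (π₂-pair ⌜ σ ⌝ _))
      (trans (cong (λ n → ⌜ σ ⌝ + 2 ^ length σ * n) (sym (+-identityʳ (suc (bit β))))) (sym (⌜++⌝ σ [ β ]))))
    (trans (cong (2 *_) (π₂-pair ⌜ σ ⌝ _)) (cong (2 ^_) (sym (trans (length-++ σ) (+-comm (length σ) 1)))))

  survivorsAt : ℕ → ℕ → ℕ → ℕ
  survivorsAt β h x = survivors (π₁ (child β x)) (π₂ (child β x)) h

  childF : ∀ {Y} → Fun Y 2
  childF = define₂ child
    (call₂ pairF (call₁ π₁F (var 1F) ⊞ call₁ π₂F (var 1F) ⊠ succ (var 0F)) (lit 2 ⊠ call₁ π₂F (var 1F)))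
    (λ _ _ → refl)

  survivorsAtF : ℕ → Fun ∅ 2
  survivorsAtF β = define₂ (survivorsAt β)
    (call₃ survivorsF (call₁ π₁F childT) (call₁ π₂F childT) (var 0F))
    (λ _ _ → refl)
    where childT = call₂ childF (lit β) (var 1F)

  survivorsAt-position : ∀ σ β h →
    survivorsAt (bit β) h (position σ) ≡ survivors ⌜ σ ++ [ β ] ⌝ (2 ^ length (σ ++ [ β ])) h
  survivorsAt-position σ β h = cong₂ (λ c p → survivors c p h)
    (trans (cong π₁ (position-child σ β)) (π₁-pair _ _)) (trans (cong π₂ (position-child σ β)) (π₂-pair _ _))

  deathF : Fun ∅ 2
  deathF = ⌊ call₂ (survivorsAtF 0) (var 0F) (var 1F) ⊠ call₂ (survivorsAtF 1) (var 0F) (var 1F) ⌋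

  verdictF : Fun ∅ 2
  verdictF = ⌊ lit 1 ⊟ call₂ (survivorsAtF 0) (var 0F) (var 1F) ⌋

  -- Waits until the subtree above one of the children of σ has died out, and then points to the other child.
  race : Code 1
  race = comp (code verdictF) (mu (code deathF) ∷ projᶜ 0F ∷ [])

  race-halts : ∀ x → (∃ λ h → survivorsAt 0 h x * survivorsAt 1 h x ≡ 0) →
               ∃ λ h → survivorsAt 0 h x * survivorsAt 1 h x ≡ 0 × ∅ ⊢ race [ x ∷ [] ]⇓ (1 ∸ survivorsAt 0 h x)
  race-halts x some with leastZero (λ h → survivorsAt 0 h x * survivorsAt 1 h x) some
  ... | h , eq , least = h , eq , ⇓-comp {ys = h ∷ x ∷ []}
    (λ { 0F → mu-correct deathF (x ∷ []) eq least ; 1F → ⇓-proj 0F }) (correct verdictF (h ∷ x ∷ []))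

  choiceF : Fun X 1
  choiceF = proj₁ (extends race)

  choice : ℕ → Bool
  -- Where `race` has no value, the extension need not be a bit, so it is rounded to one.
  choice x = nonzero (fn choiceF (x ∷ []))

  choice-correct : ∀ {x β} → ∅ ⊢ race [ x ∷ [] ]⇓ bit β → choice x ≡ β
  choice-correct {x} {β} d = trans (cong nonzero (proj₂ (extends race) x β d)) (nonzero-bit β)

  -- If the chosen child were dead, `race` would halt and `choice` would follow its verdict, which
  -- points to the sibling of a dead child. Then both children are dead, and so is `σ`. If `race`
  -- never halts, neither child ever dies and either choice is right.
  Live-choice : ∀ σ → Live σ → Live (σ ++ [ choice (position σ) ])
  Live-choice σ live h dead = decide (race-halts x (h , product≡0 (choice x) (Dead⇒survivors≡0 _ h dead)))
    where
    x = position σ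
    survivors₀ survivors₁ : ℕ → ℕ
    survivors₀ h = survivorsAt 0 h x
    survivors₁ h = survivorsAt 1 h x
    product≡0 : ∀ β → survivors ⌜ σ ++ [ β ] ⌝ (2 ^ length (σ ++ [ β ])) h ≡ 0 → survivors₀ h * survivors₁ h ≡ 0
    product≡0 false eq = cong (_* survivors₁ h) (trans (survivorsAt-position σ false h) eq)
    product≡0 true  eq =
      trans (cong (survivors₀ h *_) (trans (survivorsAt-position σ true h) eq)) (*-zeroʳ (survivors₀ h))
    dies : ∀ β h → survivorsAt (bit β) h x ≡ 0 → Dead (σ ++ [ β ]) h
    dies β h eq = survivors≡0⇒Dead (σ ++ [ β ]) h (trans (sym (survivorsAt-position σ β h)) eq)
    decide : (∃ λ h → survivors₀ h * survivors₁ h ≡ 0 × ∅ ⊢ race [ x ∷ [] ]⇓ (1 ∸ survivors₀ h)) → ⊥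
    decide (h′ , eq , d) with survivors₀ h′ in s₀≡
    ... | zero  = live _ (Dead-children σ (dies false h′ s₀≡)
                    (subst (λ β → Dead (σ ++ [ β ]) h) (choice-correct {β = true} d) dead))
    ... | suc k = live _ (Dead-children σ
                    (subst (λ β → Dead (σ ++ [ β ]) h)
                      (choice-correct {β = false} (subst (∅ ⊢ race [ x ∷ [] ]⇓_) (0∸n≡0 k) d)) dead)
                    (dies true h′ (m+n≡0⇒m≡0 (survivors₁ h′) eq)))

  state : ℕ → ℕ
  -- `pair 0 1` is the position of the empty string.
  state = primrec (pair 0 1) (λ _ r → child (1 ∸ (1 ∸ fn choiceF (r ∷ []))) r)

  path : ℕ → Bool
  path n = choice (state n)

  pathF : Fun X 1
  pathF = define₁ (bit ∘ path)
    (lit 1 ⊟ (lit 1 ⊟ call₁ choiceF (rec (var 0F) (call₂ pairF (lit 0) (lit 1))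
      (call₂ childF (lit 1 ⊟ (lit 1 ⊟ call₁ choiceF (var 1F))) (var 1F)))))
    (λ n → bit-nonzero (fn choiceF (state n ∷ [])))

  state-position : ∀ n → state n ≡ position (applyUpTo path n)
  state-position zero    = refl
  state-position (suc n) = begin
    child (1 ∸ (1 ∸ fn choiceF (state n ∷ []))) (state n)  ≡⟨ cong (λ β → child β (state n)) (bit-nonzero _) ⟩
    child (bit (path n)) (state n)                         ≡⟨ cong (child (bit (path n))) (state-position n) ⟩
    child (bit (path n)) (position (applyUpTo path n))     ≡⟨ position-child (applyUpTo path n) (path n) ⟩
    position (applyUpTo path n ++ [ path n ])              ≡⟨ cong position (applyUpTo-∷ʳ path n) ⟩
    position (applyUpTo path (suc n))                      ∎
    where open ≡-Reasoning

  Live-path : ∀ n → Live (applyUpTo path n)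
  Live-path zero    = Live-[]
  Live-path (suc n) = subst Live
    (trans (cong (λ x → applyUpTo path n ++ [ choice x ]) (sym (state-position n))) (applyUpTo-∷ʳ path n))
    (Live-choice (applyUpTo path n) (Live-path n))

  computable-path : ∃ λ (f : ℕ → Bool) → (X -Computable) (bit ∘ f) × IsPath S f
  computable-path = path , (code pathF , λ n → correct pathF (n ∷ [])) , λ n → Live⇒∈ (Live-path n)

Extends⇒PA : ∀ {X} → Extends X → HasPADegree X
Extends⇒PA = computable-path

theorem3p3 : (n : ℕ) → 2 ≤ n →
    ∃ λ (G : ComputableAbelianGroup) → let open ComputableAbelianGroup G in
    ∃ λ (b : Carrier) → b ≢ 0# ×
    ((k : ℕ) → 1 < k → (c : Coloring G k) →
    NoPairwiseMonochromaticSolution G n b c →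
    (∃ λ (m : ℤ) → 0ℤ <ᶻ m × ((i j : ℤ) → c ((i *ᶻ m) · b) ≡ c ((j *ᶻ m) · b))) →
    HasPADegree (toOracle G c))
theorem3p3 n 2≤n = computableGroup numbering , b R , b≢0 R , λ where
    k _ c none (ℤ.+ suc m , _ , mono)        → Extends⇒PA (extends R 2≤n c none m mono)
    k _ c none (ℤ.+ zero , ℤ.+<+ () , _)
    k _ c none (ℤ.-[1+ _ ] , () , _)
  where
  open LeastNumbers using (computableGroup; realises)
  R = realises numbering
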